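{- For every integer $k\ge 3$ there exist $\varepsilon>0$ and $n_0\in\mathbb{N}$ such that for all $n>n_0$ there exists a pair of $k$-ary structures $\mathcal{A},\mathcal{B}$ over a common signature with $|A|=|B|=n$ such that some sentence of $\mathcal{L}^k$ distinguishes $\mathcal{A}$ from $\mathcal{B}$, but $\mathcal{A}$ and $\mathcal{B}$ agree on every sentence of $\mathcal{L}^k$ with fewer than $2^{\varepsilon n}$ quantifiers.
   Context: All structures are finite and relational, with a finite signature (the signature is not fixed in advance and may depend on $n$). A $k$-ary structure is a structure all of whose relations have arity at most $k$. $A$ and $B$ denote the domains of $\mathcal{A}$ and $\mathcal{B}$. $\mathcal{L}^k$ is the set of first-order formulas (with equality) using only the variables $x_1,\dots,x_k$ (variables may be requantified). The number of quantifiers of a formula is the total number of occurrences of $\exists$ and $\forall$ in it. Two structures agree on a sentence if both satisfy it or neither does; a sentence distinguishes two structures if they do not agree on it. -}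

module Defs where

open import Data.Bool.Base using (Bool; T)
open import Data.Fin.Base using (Fin)
open import Data.Integer.Base using (+_; -[1+_])
open import Data.Nat.Base using (ℕ; suc; _+_; _*_; _^_; _<_; _≤_)
open import Data.Product.Base using (Σ-syntax; _×_; proj₁)
open import Data.Rational.Unnormalised.Base using (ℚᵘ; mkℚᵘ)
open import Data.Sum.Base using (_⊎_)
open import Data.Vec.Base using (Vec; lookup; map; _[_]≔_)
open import Data.Vec.Membership.Propositional using (_∈_)
open import Function.Bundles using (_↔_)
open import Relation.Binary.PropositionalEquality using (_≡_; _≢_)
open import Relation.Nullary.Negation using (¬_)

record Signature : Set where
  field
    symbols : ℕ
    arity   : Fin symbols → ℕ

  Symbol : Set
  Symbol = Fin symbols

open Signature public

-- Relations are given by their characteristic functions. On finite domains every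
-- formula is then decidable, so the reading of the connectives and
-- quantifiers in _,_⊨_ below agrees with the classical one.
record Structure (σ : Signature) : Set₁ where
  field
    Carrier : Set
    rel     : (R : Symbol σ) → Vec Carrier (arity σ R) → Bool

open Structure public

HasSize : ∀ {σ} → Structure σ → ℕ → Set
HasSize 𝒜 n = Carrier 𝒜 ↔ Fin n

IsAry : ℕ → ∀ {σ} → Structure σ → Set
IsAry k {σ} _ = (R : Symbol σ) → arity σ R ≤ k

infix  9 _≐_
infixr 7 _∧′_
infixr 6 _∨′_

-- Variables are names in Fin k, not de Bruijn indices: a quantifier may rebind a
-- variable that is already bound.
data Formula (σ : Signature) (k : ℕ) : Set where
  atom      : (R : Symbol σ) → Vec (Fin k) (arity σ R) → Formula σ k
  _≐_       : Fin k → Fin k → Formula σ k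
  ¬′_       : Formula σ k → Formula σ k
  _∧′_ _∨′_ : Formula σ k → Formula σ k → Formula σ k
  ∃′ ∀′     : Fin k → Formula σ k → Formula σ k

module _ {σ : Signature} {k : ℕ} where

  infix 4 _FreeIn_

  _FreeIn_ : Fin k → Formula σ k → Set
  x FreeIn atom R ys = x ∈ ys
  x FreeIn (y ≐ z)   = x ≡ y ⊎ x ≡ z
  x FreeIn (¬′ φ)    = x FreeIn φ
  x FreeIn (φ ∧′ ψ)  = x FreeIn φ ⊎ x FreeIn ψ
  x FreeIn (φ ∨′ ψ)  = x FreeIn φ ⊎ x FreeIn ψ
  x FreeIn ∃′ y φ    = x ≢ y × x FreeIn φ
  x FreeIn ∀′ y φ    = x ≢ y × x FreeIn φ

  quantifiers : Formula σ k → ℕ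
  quantifiers (atom R ys) = 0
  quantifiers (y ≐ z)     = 0
  quantifiers (¬′ φ)      = quantifiers φ
  quantifiers (φ ∧′ ψ)    = quantifiers φ + quantifiers ψ
  quantifiers (φ ∨′ ψ)    = quantifiers φ + quantifiers ψ
  quantifiers (∃′ y φ)    = suc (quantifiers φ)
  quantifiers (∀′ y φ)    = suc (quantifiers φ)

  infix 4 _,_⊨_

  _,_⊨_ : (𝒜 : Structure σ) → Vec (Carrier 𝒜) k → Formula σ k → Set
  𝒜 , s ⊨ atom R ys = T (rel 𝒜 R (map (lookup s) ys))
  𝒜 , s ⊨ (y ≐ z)   = lookup s y ≡ lookup s z
  𝒜 , s ⊨ (¬′ φ)    = ¬ (𝒜 , s ⊨ φ)
  𝒜 , s ⊨ (φ ∧′ ψ)  = (𝒜 , s ⊨ φ) × (𝒜 , s ⊨ ψ)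
  𝒜 , s ⊨ (φ ∨′ ψ)  = (𝒜 , s ⊨ φ) ⊎ (𝒜 , s ⊨ ψ)
  𝒜 , s ⊨ ∃′ y φ    = Σ[ a ∈ Carrier 𝒜 ] (𝒜 , s [ y ]≔ a ⊨ φ)
  𝒜 , s ⊨ ∀′ y φ    = (a : Carrier 𝒜) → 𝒜 , s [ y ]≔ a ⊨ φ

Sentence : Signature → ℕ → Set
Sentence σ k = Σ[ φ ∈ Formula σ k ] (∀ x → ¬ (x FreeIn φ))

module _ {σ : Signature} {k : ℕ} where

  infix 4 _⊨_

  -- The truth of a sentence does not depend on the assignment; on a nonempty
  -- domain, quantifying over all assignments is therefore the same as picking one.
  _⊨_ : Structure σ → Sentence σ k → Set
  𝒜 ⊨ φ = (s : Vec (Carrier 𝒜) k) → 𝒜 , s ⊨ proj₁ φ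

  AgreeOn : Structure σ → Structure σ → Sentence σ k → Set
  AgreeOn 𝒜 ℬ φ = (𝒜 ⊨ φ × ℬ ⊨ φ) ⊎ (¬ (𝒜 ⊨ φ) × ¬ (ℬ ⊨ φ))

  Distinguishes : Sentence σ k → Structure σ → Structure σ → Set
  Distinguishes φ 𝒜 ℬ = ¬ AgreeOn 𝒜 ℬ φ

infix 4 _<2^_

-- The real inequality m < 2^q for rational q, with both sides raised to the
-- power of the denominator (suc d) and negative powers of 2 cleared.
_<2^_ : ℕ → ℚᵘ → Set
m <2^ mkℚᵘ (+ p)    d = m ^ suc d < 2 ^ p
m <2^ mkℚᵘ -[1+ p ] d = m ^ suc d * 2 ^ suc p < 1

-- Elements carry a type τ < k, a level l ≤ D and a value modulo k! + 1; a tuple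
-- (yτ) with one element of each type satisfies the relation when certain linear
-- equations in ∑ yτ and ∑ τ·yτ hold. Write E τ y = ∑ ρ·yρ − τ·∑ yρ: it does not
-- involve yτ, and any two of the E τ determine the pair of sums because nonzero
-- differences of types are units. The all-zero tuple solves the equations of the
-- first structure; in the second, ∑ yτ = 1 at the top level, so some E τ is not 0.
--
-- Spoiler carries a nonzero E τ down to level 0, where every E must vanish: placing
-- yτ makes E a or E b nonzero, and both cases have to be pursued with a or b
-- lowered; when only one type is left above level d, the relation ∑ yτ = 0
-- leaves one case. The branching is what costs exponentially many quantifiers.
--
-- For the lower bound, a pair of pebblings is given a cost X such that no formula
-- with fewer than X quantifiers separates it: a nonzero E is allowed if it is read
-- off pebbles on high levels. To a new pebble Duplicator has two answers whose
-- costs add up to at least X and only one of which has to succeed, so the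
-- quantifiers spent on the two sides of a conjunction add up.
module Submission where

open import Algebra.Properties.CommutativeSemigroup using (x∙yz≈y∙xz)
open import Data.Bool.Base using (T)
open import Data.Empty using (⊥; ⊥-elim)
open import Data.Fin.Base as Fin using (Fin; zero; suc; toℕ)
import Data.Fin.Properties as Fin
open import Data.Integer.Base as ℤ using (ℤ; +_; ∣_∣; 0ℤ; 1ℤ)
import Data.Integer.DivMod as ℤ
open import Data.Integer.Divisibility.Signed as Signed using (_∣_; divides; _∣?_)
import Data.Integer.Properties as ℤ
open import Data.Integer.Tactic.RingSolver using (solve-∀)
open import Data.List.Base as List using (List; []; _∷_)
open import Data.List.Membership.Propositional using (_∈_)
open import Data.List.Membership.Propositional.Properties using (∈-allFin)
open import Data.List.Relation.Unary.Any using (here; there)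
open import Data.Maybe.Base using (Maybe; just; nothing)
import Data.Maybe.Properties as Maybe
open import Data.Nat.Base hiding (_/_)
import Data.Nat.DivMod as DivMod
import Data.Nat.Divisibility as ℕ
open import Data.Nat.Properties
open import Data.Product.Base using (Σ-syntax; ∃; ∃-syntax; _×_; _,_; proj₁; proj₂)
open import Data.Product.Function.NonDependent.Propositional using (_×-cong_)
open import Data.Rational.Unnormalised.Base using (ℚᵘ; mkℚᵘ; 0ℚᵘ; _/_; *<*) renaming (_<_ to _<ᵘ_; _*_ to _*ᵘ_)
open import Data.Sum.Base using (_⊎_; inj₁; inj₂; [_,_]′)
open import Data.Sum.Function.Propositional using (_⊎-cong_)
open import Data.Unit.Base using (⊤; tt)
open import Data.Vec.Base as Vec using (Vec; []; _∷_; lookup; _[_]≔_)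
import Data.Vec.Membership.Propositional as VecMembership
import Data.Vec.Properties as Vec
import Data.Vec.Relation.Unary.Any as VecAny
open import Function.Base using (_∘_; id; case_of_)
open import Function.Bundles using (_↔_; Inverse; Injection)
open import Function.Properties.Inverse using (Inverse⇒Injection; ↔-refl; ↔-sym; ↔-trans)
open import Relation.Binary.Definitions using (tri<; tri≈; tri>)
open import Relation.Binary.PropositionalEquality
open import Relation.Nullary
open import Relation.Nullary.Decidable using (⌊_⌋; toWitness; fromWitness; map′; T?)
open import Defs

-- Costs of pebble levels and their triangle inequalities.

-- The cost of exploiting a violated equation among pebbles at levels a and b,
-- and (hop) that of exploiting two pebbles of one type that moved differently.
opaque
  cost hop : ℕ → ℕ → ℕ
  cost a b with a ≟ b
  ... | yes _ = 2 ^ a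
  ... | no  _ = 2 ^ pred (a ⊔ b)
  hop a b with a ≟ b
  ... | yes _ = 0
  ... | no  _ = 2 ^ pred (a ⊔ b)

  cost-refl : ∀ {a b} → a ≡ b → cost a b ≡ 2 ^ a
  cost-refl {a} {b} a≡b with a ≟ b
  ... | yes _   = refl
  ... | no  a≢b = contradiction a≡b a≢b

  cost-≢ : ∀ {a b} → a ≢ b → cost a b ≡ 2 ^ pred (a ⊔ b)
  cost-≢ {a} {b} a≢b with a ≟ b
  ... | yes a≡b = contradiction a≡b a≢b
  ... | no  _   = refl

  hop-refl : ∀ {a b} → a ≡ b → hop a b ≡ 0
  hop-refl {a} {b} a≡b with a ≟ b
  ... | yes _   = refl
  ... | no  a≢b = contradiction a≡b a≢b

  hop-≢ : ∀ {a b} → a ≢ b → hop a b ≡ 2 ^ pred (a ⊔ b)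
  hop-≢ {a} {b} a≢b with a ≟ b
  ... | yes a≡b = contradiction a≡b a≢b
  ... | no  _   = refl

2^-mono-≤ : ∀ {m n} → m ≤ n → 2 ^ m ≤ 2 ^ n
2^-mono-≤ = ^-monoʳ-≤ 2

2^-double : ∀ {n} → 0 < n → 2 ^ n ≡ 2 ^ pred n + 2 ^ pred n
2^-double {suc n} _ = cong (λ m → 2 ^ n + m) (+-identityʳ (2 ^ n))

cost-sym : ∀ a b → cost a b ≡ cost b a
cost-sym a b with a ≟ b
... | yes refl = refl
... | no  a≢b  = trans (cost-≢ a≢b)
  (trans (cong (λ m → 2 ^ pred m) (⊔-comm a b)) (sym (cost-≢ (a≢b ∘ sym))))

hop-sym : ∀ a b → hop a b ≡ hop b a
hop-sym a b with a ≟ b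
... | yes refl = refl
... | no  a≢b  = trans (hop-≢ a≢b)
  (trans (cong (λ m → 2 ^ pred m) (⊔-comm a b)) (sym (hop-≢ (a≢b ∘ sym))))

cost-lower : ∀ a b → 2 ^ pred a ≤ cost a b
cost-lower a b with a ≟ b
... | yes a≡b = ≤-trans (2^-mono-≤ (pred[n]≤n {a})) (≤-reflexive (sym (cost-refl a≡b)))
... | no  a≢b = ≤-trans (2^-mono-≤ (pred-mono-≤ (m≤m⊔n a b))) (≤-reflexive (sym (cost-≢ a≢b)))

cost-lowerʳ : ∀ a b → 2 ^ pred b ≤ cost a b
cost-lowerʳ a b = ≤-trans (cost-lower b a) (≤-reflexive (cost-sym b a))

-- A nonzero `hop` is `2 ^ pred` of the higher level, and a pebble on that level costs at least as
-- much next to any third one.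
hop≤⇒cost≤ : ∀ {X a b} → 0 < X → X ≤ hop a b → (∀ c → X ≤ cost a c) ⊎ (∀ c → X ≤ cost b c)
hop≤⇒cost≤ {X} {a} {b} X>0 X≤ with a ≟ b
... | yes a≡b = contradiction (≤-trans X>0 (≤-trans X≤ (≤-reflexive (hop-refl a≡b)))) λ()
... | no  a≢b with ≤-total b a
...   | inj₁ b≤a = inj₁ λ c → ≤-trans X≤ (≤-trans (≤-reflexive
        (trans (hop-≢ a≢b) (cong (λ m → 2 ^ pred m) (m≥n⇒m⊔n≡m b≤a)))) (cost-lower a c))
...   | inj₂ a≤b = inj₂ λ c → ≤-trans X≤ (≤-trans (≤-reflexive
        (trans (hop-≢ a≢b) (cong (λ m → 2 ^ pred m) (m≤n⇒m⊔n≡n a≤b)))) (cost-lower b c))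

-- For distinct `a` and `c` one summand alone covers the higher level. If `a ≡ c` and `b` differs,
-- the left side is a full power `2 ^ a`, and the two summands contribute equal halves of a power at
-- least as large. By this inequality Duplicator's two answers for twin pebbles share the cost.
cost-triangle : ∀ a b c → cost a c ≤ hop a b + cost b c
cost-triangle a b c with a ≟ b
... | yes refl = m≤n+m _ _
... | no  a≢b with a ≟ c
...   | yes refl = begin
        cost a a                                    ≡⟨ cost-refl refl ⟩
        2 ^ a                                       ≤⟨ 2^-mono-≤ (m≤m⊔n a b) ⟩
        2 ^ (a ⊔ b)                                 ≡⟨ 2^-double 0<a⊔b ⟩
        2 ^ pred (a ⊔ b) + 2 ^ pred (a ⊔ b)         ≡⟨ cong₂ _+_ (hop-≢ a≢b) (trans (cost-sym b a) (cost-≢ a≢b)) ⟨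
        hop a b + cost b a                          ∎
  where
  open ≤-Reasoning
  0<a⊔b : 0 < a ⊔ b
  0<a⊔b with a ⊔ b in eq
  ... | suc _ = z<s
  ... | zero  = contradiction (trans (n≤0⇒n≡0 (≤-trans (m≤m⊔n a b) (≤-reflexive eq)))
                  (sym (n≤0⇒n≡0 (≤-trans (m≤n⊔m a b) (≤-reflexive eq))))) a≢b
...   | no a≢c with ≤-total c a
...     | inj₁ c≤a = ≤-trans (≤-reflexive (trans (cost-≢ a≢c) (cong (λ m → 2 ^ pred m) (m≥n⇒m⊔n≡m c≤a))))
          (≤-trans (2^-mono-≤ (pred-mono-≤ (m≤m⊔n a b)))
          (≤-trans (≤-reflexive (sym (hop-≢ a≢b))) (m≤m+n _ _)))
...     | inj₂ a≤c = ≤-trans (≤-reflexive (trans (cost-≢ a≢c) (cong (λ m → 2 ^ pred m) (m≤n⇒m⊔n≡n a≤c))))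
          (≤-trans (cost-lowerʳ b c) (m≤n+m _ _))

-- The ultrametric inequality: unequal levels enter `hop` only through their maximum, and the higher
-- end either differs from `b` or can be traded for it.
hop-ultra : ∀ {X} a b c → X ≤ hop a c → X ≤ hop a b ⊎ X ≤ hop b c
hop-ultra {X} a b c X≤ with a ≟ c | a ≟ b | b ≟ c
... | yes a≡c | _ | _ = inj₁ (≤-trans X≤ (≤-trans (≤-reflexive (hop-refl a≡c)) z≤n))
... | no _ | yes refl | _ = inj₂ X≤
... | no _ | no _ | yes refl = inj₁ X≤
... | no a≢c | no a≢b | no b≢c with ≤-total c a
...   | inj₁ c≤a = inj₁ (≤-trans X≤ (≤-trans (≤-reflexive
        (trans (hop-≢ a≢c) (cong (λ m → 2 ^ pred m) (m≥n⇒m⊔n≡m c≤a))))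
        (≤-trans (2^-mono-≤ (pred-mono-≤ (m≤m⊔n a b))) (≤-reflexive (sym (hop-≢ a≢b))))))
...   | inj₂ a≤c = inj₂ (≤-trans X≤ (≤-trans (≤-reflexive
        (trans (hop-≢ a≢c) (cong (λ m → 2 ^ pred m) (m≤n⇒m⊔n≡n a≤c))))
        (≤-trans (2^-mono-≤ (pred-mono-≤ (m≤n⊔m b c))) (≤-reflexive (sym (hop-≢ b≢c))))))

-- Caps both shares at `X`, so that facts known at cost `X` can be weakened to either share.
≤+⇒≤⊓+⊓ : ∀ {X} m n → X ≤ m + n → X ≤ (X ⊓ m) + (X ⊓ n)
≤+⇒≤⊓+⊓ {X} m n X≤ with ≤-total X m | ≤-total X n
... | inj₁ X≤m | _ = ≤-trans (≤-reflexive (sym (m≤n⇒m⊓n≡m X≤m))) (m≤m+n _ _)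
... | inj₂ _ | inj₁ X≤n = ≤-trans (≤-reflexive (sym (m≤n⇒m⊓n≡m X≤n))) (m≤n+m _ _)
... | inj₂ m≤X | inj₂ n≤X = ≤-trans X≤ (≤-reflexive (sym (cong₂ _+_ (m≥n⇒m⊓n≡n m≤X) (m≥n⇒m⊓n≡n n≤X))))

-- Point updates and linear forms over the integers.

infixl 9 _[_↦_]

_[_↦_] : ∀ {n} {A : Set} → (Fin n → A) → Fin n → A → Fin n → A
(y [ i ↦ d ]) j with j Fin.≟ i
... | yes _ = d
... | no  _ = y j

↦-at : ∀ {n} {A : Set} (y : Fin n → A) {i j d} → j ≡ i → (y [ i ↦ d ]) j ≡ d
↦-at y {i} {j} j≡i with j Fin.≟ i
... | yes _   = refl
... | no  j≢i = contradiction j≡i j≢i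

↦-off : ∀ {n} {A : Set} (y : Fin n → A) {i j d} → j ≢ i → (y [ i ↦ d ]) j ≡ y j
↦-off y {i} {j} j≢i with j Fin.≟ i
... | yes j≡i = contradiction j≡i j≢i
... | no  _   = refl

↦-suc : ∀ {n} {A : Set} (y : Fin (suc n) → A) i d j →
        (y [ suc i ↦ d ]) (suc j) ≡ ((y ∘ suc) [ i ↦ d ]) j
↦-suc y i d j with j Fin.≟ i
... | yes _ = refl
... | no  _ = refl

form : ∀ {n} → (Fin n → ℤ) → (Fin n → ℤ) → ℤ
form {zero}  c y = 0ℤ
form {suc n} c y = c zero ℤ.* y zero ℤ.+ form (c ∘ suc) (y ∘ suc)

form-cong : ∀ {n} c {y y′ : Fin n → ℤ} → (∀ i → y i ≡ y′ i) → form c y ≡ form c y′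
form-cong {zero}  c eq = refl
form-cong {suc n} c eq = cong₂ (λ a b → c zero ℤ.* a ℤ.+ b) (eq zero) (form-cong (c ∘ suc) (eq ∘ suc))

form-+ : ∀ {n} (c y z : Fin n → ℤ) → form c (λ i → y i ℤ.+ z i) ≡ form c y ℤ.+ form c z
form-+ {zero}  c y z = refl
form-+ {suc n} c y z rewrite form-+ (c ∘ suc) (y ∘ suc) (z ∘ suc) =
  lemma (c zero) (y zero) (z zero) (form (c ∘ suc) (y ∘ suc)) (form (c ∘ suc) (z ∘ suc))
  where
  lemma : ∀ c y z a b → c ℤ.* (y ℤ.+ z) ℤ.+ (a ℤ.+ b) ≡ (c ℤ.* y ℤ.+ a) ℤ.+ (c ℤ.* z ℤ.+ b)
  lemma = solve-∀

form-neg : ∀ {n} (c y : Fin n → ℤ) → form c (λ i → ℤ.- y i) ≡ ℤ.- form c y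
form-neg {zero}  c y = refl
form-neg {suc n} c y rewrite form-neg (c ∘ suc) (y ∘ suc) =
  lemma (c zero) (y zero) (form (c ∘ suc) (y ∘ suc))
  where
  lemma : ∀ c y a → c ℤ.* (ℤ.- y) ℤ.+ ℤ.- a ≡ ℤ.- (c ℤ.* y ℤ.+ a)
  lemma = solve-∀

-- Meant for `E a` and `E b`, whose coefficients differ by a constant.
form-coeff : ∀ {n} (c c′ : Fin n → ℤ) e (y : Fin n → ℤ) → (∀ i → c i ≡ c′ i ℤ.+ e) →
             form c y ≡ form c′ y ℤ.+ e ℤ.* form (λ _ → 1ℤ) y
form-coeff {zero}  c c′ e y eq = sym (trans (ℤ.+-identityˡ _) (ℤ.*-zeroʳ e))
form-coeff {suc n} c c′ e y eq
  rewrite eq zero | form-coeff (c ∘ suc) (c′ ∘ suc) e (y ∘ suc) (eq ∘ suc) =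
  lemma (c′ zero) e (y zero) (form (c′ ∘ suc) (y ∘ suc)) (form (λ _ → 1ℤ) (y ∘ suc))
  where
  lemma : ∀ c e y a b → (c ℤ.+ e) ℤ.* y ℤ.+ (a ℤ.+ e ℤ.* b) ≡ (c ℤ.* y ℤ.+ a) ℤ.+ e ℤ.* (1ℤ ℤ.* y ℤ.+ b)
  lemma = solve-∀

form-↦ : ∀ {n} (c y : Fin n → ℤ) i d → form c (y [ i ↦ d ]) ≡ c i ℤ.* (d ℤ.- y i) ℤ.+ form c y
form-↦ {suc n} c y zero d = lemma (c zero) d (y zero) (form (c ∘ suc) (y ∘ suc))
  where
  lemma : ∀ c d y a → c ℤ.* d ℤ.+ a ≡ c ℤ.* (d ℤ.- y) ℤ.+ (c ℤ.* y ℤ.+ a)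
  lemma = solve-∀
form-↦ {suc n} c y (suc i) d
  rewrite form-cong (c ∘ suc) (↦-suc y i d)
        | form-↦ (c ∘ suc) (y ∘ suc) i d =
  lemma (c zero ℤ.* y zero) (c (suc i) ℤ.* (d ℤ.- y (suc i))) (form (c ∘ suc) (y ∘ suc))
  where
  lemma : ∀ a b c → a ℤ.+ (b ℤ.+ c) ≡ b ℤ.+ (a ℤ.+ c)
  lemma = solve-∀

-- Residues in which nonzero differences of types are units.

-- Modulo k! + 1 every nonzero integer of absolute value at most k is a unit:
-- it divides k! ≡ -1.
module Residues (k : ℕ) where

  modulus : ℕ
  modulus = suc (k !)

  Null : ℤ → Set
  Null x = + modulus ∣ x

  Null? : ∀ x → Dec (Null x)
  Null? x = + modulus ∣? x

  null-0 : Null 0ℤ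
  null-0 = divides 0ℤ refl

  null-+ : ∀ {x y} → Null x → Null y → Null (x ℤ.+ y)
  null-+ = Signed.∣m∣n⇒∣m+n

  null-neg : ∀ {x} → Null x → Null (ℤ.- x)
  null-neg = Signed.∣m⇒∣-m

  null-* : ∀ x {y} → Null y → Null (x ℤ.* y)
  null-* = Signed.∣n⇒∣m*n

  null-form : ∀ {n} (c y : Fin n → ℤ) → (∀ i → Null (c i ℤ.* y i)) → Null (form c y)
  null-form {zero}  c y null = null-0
  null-form {suc n} c y null = null-+ (null zero) (null-form (c ∘ suc) (y ∘ suc) (null ∘ suc))

  Z₁ : (Fin k → ℤ) → ℤ
  Z₁ = form (λ _ → 1ℤ)

  coeff : Fin k → Fin k → ℤ
  coeff τ ρ = + toℕ ρ ℤ.- + toℕ τ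

  -- ∑ ρ·yρ − τ·∑ yρ, which does not involve yτ.
  E : Fin k → (Fin k → ℤ) → ℤ
  E τ = form (coeff τ)

  opaque
    -- The witness is the quotient of `k !` by the coefficient, which is minus its inverse. Later
    -- steps use only the congruence.
    unit : ∀ {a b} → a ≢ b → ∃[ u ] Null (coeff a b ℤ.* u ℤ.+ 1ℤ)
    unit {a} {b} a≢b = u , divides 1ℤ (begin
      c ℤ.* u ℤ.+ 1ℤ        ≡⟨ cong (ℤ._+ 1ℤ) (ℤ.*-comm c u) ⟩
      u ℤ.* c ℤ.+ 1ℤ        ≡⟨ cong (ℤ._+ 1ℤ) (_∣_.equality c∣k!) ⟨
      + (k !) ℤ.+ 1ℤ        ≡⟨ cong +_ (+-comm (k !) 1) ⟩
      + modulus             ≡⟨ ℤ.*-identityˡ (+ modulus) ⟨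
      1ℤ ℤ.* + modulus      ∎)
      where
      open ≡-Reasoning
      c : ℤ
      c = coeff a b
      divides-! : ∀ m → m ≢ 0 → m ≤ k → m ℕ.∣ k !
      divides-! zero    m≢0 _   = contradiction refl m≢0
      divides-! (suc m) _   m≤k = ℕ.∣-trans (ℕ.m∣m*n (m !)) (ℕ.m≤n⇒m!∣n! m≤k)
      small : ∣ c ∣ ≤ k
      small = ≤-trans (≤-reflexive (cong ∣_∣ (ℤ.[+m]-[+n]≡m⊖n (toℕ b) (toℕ a))))
        (≤-trans (ℤ.∣m⊝n∣≤m⊔n (toℕ b) (toℕ a)) (⊔-lub (<⇒≤ (Fin.toℕ<n b)) (<⇒≤ (Fin.toℕ<n a))))
      c∣k! : c ∣ + (k !)
      c∣k! = Signed.∣ᵤ⇒∣ (divides-! ∣ c ∣ (λ c≡0 → a≢b (sym (Fin.toℕ-injective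
        (ℤ.+-injective (ℤ.i-j≡0⇒i≡j _ _ (ℤ.∣i∣≡0⇒i≡0 c≡0)))))) small)
      u : ℤ
      u = _∣_.quotient c∣k!

  -- Multiply the unit relation by `w` and subtract `u` times the hypothesis.
  cancel : ∀ {a b} w → a ≢ b → Null (coeff a b ℤ.* w) → Null w
  cancel {a} {b} w a≢b null with unit a≢b
  ... | u , cu+1 = subst Null (lemma (coeff a b) u w)
          (null-+ (null-* w cu+1) (null-neg (null-* u null)))
    where
    lemma : ∀ c u w → w ℤ.* (c ℤ.* u ℤ.+ 1ℤ) ℤ.+ (ℤ.- (u ℤ.* (c ℤ.* w))) ≡ w
    lemma = solve-∀

  E-change : ∀ a b y → E a y ≡ E b y ℤ.+ coeff a b ℤ.* Z₁ y
  E-change a b y = form-coeff (coeff a) (coeff b) (coeff a b) y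
    (λ i → lemma (+ toℕ i) (+ toℕ a) (+ toℕ b))
    where
    lemma : ∀ i a b → i ℤ.- a ≡ (i ℤ.- b) ℤ.+ (b ℤ.- a)
    lemma = solve-∀

  E-all : ∀ {a} b y → Null (Z₁ y) → Null (E a y) → Null (E b y)
  E-all {a} b y Z₁0 Ea = subst Null (sym (E-change b a y)) (null-+ Ea (null-* (coeff b a) Z₁0))

  -- The two forms differ by `coeff a b` times `Z₁`, and that coefficient is a unit.
  Z₁-null : ∀ {a b} y → a ≢ b → Null (E a y) → Null (E b y) → Null (Z₁ y)
  Z₁-null {a} {b} y a≢b Ea Eb = cancel _ a≢b (subst Null
    (trans (cong (ℤ._- E b y) (E-change a b y)) (lemma (E b y) _)) (null-+ Ea (null-neg Eb)))
    where
    lemma : ∀ x w → (x ℤ.+ w) ℤ.+ (ℤ.- x) ≡ w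
    lemma = solve-∀

  form-resp : ∀ c {y y′} → (∀ ρ → Null (c ρ ℤ.* (y′ ρ ℤ.- y ρ))) → Null (form {k} c y) → Null (form c y′)
  form-resp c {y} {y′} diff null = subst Null
    (sym (trans (form-cong c (λ i → lemma (y i) (y′ i))) (form-+ c y _)))
    (null-+ null (null-form c _ diff))
    where
    lemma : ∀ a b → b ≡ a ℤ.+ (b ℤ.- a)
    lemma = solve-∀

  -- The coefficient at `τ` is zero, so a change of that coordinate is invisible.
  E-resp : ∀ τ {y y′} → (∀ ρ → ρ ≢ τ → Null (y′ ρ ℤ.- y ρ)) → Null (E τ y) → Null (E τ y′)
  E-resp τ {y} {y′} diff = form-resp (coeff τ) step
    where
    step : ∀ ρ → Null (coeff τ ρ ℤ.* (y′ ρ ℤ.- y ρ))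
    step ρ with ρ Fin.≟ τ
    ... | no  ρ≢τ  = null-* (coeff τ ρ) (diff ρ ρ≢τ)
    ... | yes refl = subst Null (sym (cong (ℤ._* (y′ ρ ℤ.- y ρ)) (ℤ.+-inverseʳ (+ toℕ ρ)))) null-0

  null-≡ : ∀ {x y} → x ≡ y → Null (x ℤ.- y)
  null-≡ {x} refl = subst Null (sym (ℤ.+-inverseʳ x)) null-0

  form-resp-− : ∀ c {e} {y y′} → (∀ ρ → Null (y′ ρ ℤ.- y ρ)) → Null (form {k} c y ℤ.- e) → Null (form c y′ ℤ.- e)
  form-resp-− c {e} {y} {y′} diff null = subst Null
    (trans (lemma′ (form c y) e (form c (λ ρ → y′ ρ ℤ.- y ρ))) (cong (ℤ._- e) (sym (trans (form-cong c (λ i → lemma (y i) (y′ i))) (form-+ c y _)))))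
    (null-+ null (null-form c _ (λ i → null-* (c i) (diff i))))
    where
    lemma : ∀ a b → b ≡ a ℤ.+ (b ℤ.- a)
    lemma = solve-∀
    lemma′ : ∀ a e b → (a ℤ.- e) ℤ.+ b ≡ (a ℤ.+ b) ℤ.- e
    lemma′ = solve-∀

  -- Shifting coordinate `τ` by `u` times the excess over `e` changes the form by minus that excess,
  -- because `c τ` times `u` is congruent to minus one.
  form-solve : ∀ c y τ u e → Null (c τ ℤ.* u ℤ.+ 1ℤ) → ∃[ d ] Null (form {k} c (y [ τ ↦ d ]) ℤ.- e)
  form-solve c y τ u e null = y τ ℤ.+ u ℤ.* (form c y ℤ.- e) ,
    subst Null (sym (trans (cong (ℤ._- e) (form-↦ c y τ _)) (lemma (c τ) u (y τ) (form c y) e)))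
      (null-* (form c y ℤ.- e) null)
    where
    lemma : ∀ c u y f e → (c ℤ.* ((y ℤ.+ u ℤ.* (f ℤ.- e)) ℤ.- y) ℤ.+ f) ℤ.- e
                        ≡ (f ℤ.- e) ℤ.* (c ℤ.* u ℤ.+ 1ℤ)
    lemma = solve-∀

  Z₁-solve : ∀ y τ e → ∃[ d ] Null (Z₁ (y [ τ ↦ d ]) ℤ.- e)
  Z₁-solve y τ e = form-solve (λ _ → 1ℤ) y τ (ℤ.- 1ℤ) e null-0

  E-solve : ∀ {ρ τ} y → ρ ≢ τ → ∃[ d ] Null (E ρ (y [ τ ↦ d ]))
  E-solve {ρ} {τ} y ρ≢τ with unit ρ≢τ
  ... | u , null with form-solve (coeff ρ) y τ u 0ℤ null
  ...   | d , null′ = d , subst Null (ℤ.+-identityʳ _) null′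

  E-neg : ∀ τ {y} → Null (E τ y) → Null (E τ (λ ρ → ℤ.- y ρ))
  E-neg τ {y} null = subst Null (sym (form-neg (coeff τ) y)) (null-neg null)

-- Laws on a tuple showing all types, and Duplicator's answer there.

third : ∀ {k} → 3 ≤ k → (a b : Fin k) → ∃[ c ] c ≢ a × c ≢ b
third (s≤s (s≤s (s≤s _))) a b with a Fin.≟ b
... | yes refl = Fin.punchIn a zero , Fin.punchInᵢ≢i a zero , Fin.punchInᵢ≢i a zero
... | no  a≢b  = Fin.punchIn a c , Fin.punchInᵢ≢i a c ,
  λ eq → Fin.punchInᵢ≢i (Fin.punchOut a≢b) zero
    (Fin.punchIn-injective a _ _ (trans eq (sym (Fin.punchIn-punchOut a≢b))))
  where c = Fin.punchIn (Fin.punchOut a≢b) zero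

module Levels (k : ℕ) (3≤k : 3 ≤ k) (D : ℕ) where

  open Residues k public

  o : Fin k
  o = Fin.fromℕ< (≤-trans (s≤s z≤n) 3≤k)

  -- One type sits a single level above all others: the position in which Spoiler descends without
  -- branching.
  Hyper : (Fin k → ℕ) → Set
  Hyper l = ∃[ σ ] (∀ ρ → ρ ≢ σ → l σ ≡ suc (l ρ))

  Const : ℕ → (Fin k → ℕ) → Set
  Const d l = ∀ ρ → l ρ ≡ d

  -- The equations imposed on a tuple with one element of each type; only those
  -- at the top level tell the two structures apart (δ = 0 or δ = ±1).
  Legal : ℤ → (Fin k → ℕ) → (Fin k → ℤ) → Set
  Legal δ l y = (Hyper l → Null (Z₁ y))
              × (Const 0 l → Null (Z₁ y) × Null (E o y))
              × (Const D l → Null (Z₁ y ℤ.- δ))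

  Hyper? : ∀ l → Dec (Hyper l)
  Hyper? l = Fin.any? λ σ → Fin.all? λ ρ → ¬? (ρ Fin.≟ σ) →-dec (l σ ≟ suc (l ρ))

  Const? : ∀ d l → Dec (Const d l)
  Const? d l = Fin.all? λ ρ → l ρ ≟ d

  Legal? : ∀ δ l y → Dec (Legal δ l y)
  Legal? δ l y = (Hyper? l →-dec Null? _)
           ×-dec (Const? 0 l →-dec (Null? _ ×-dec Null? _))
           ×-dec (Const? D l →-dec Null? _)

  -- The price of a nonzero `E τ` is read off two types other than `τ`, as `E τ` does not see the
  -- pebble of type `τ`.
  Dear : ℕ → (Fin k → ℕ) → Fin k → Set
  Dear X l τ = ∃[ a ] ∃[ b ] a ≢ b × a ≢ τ × b ≢ τ × X ≤ cost (l a) (l b)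

  Ok : ℕ → (Fin k → ℕ) → Fin k → (Fin k → ℤ) → Set
  Ok X l τ y = Null (E τ y) ⊎ Dear X l τ

  Ok-resp : ∀ {X X′ l l′ τ y y′} → X′ ≤ X → (∀ ρ → ρ ≢ τ → l′ ρ ≡ l ρ) →
            (∀ ρ → ρ ≢ τ → Null (y′ ρ ℤ.- y ρ)) → Ok X l τ y → Ok X′ l′ τ y′
  Ok-resp X′≤X l′≗l y′≈y (inj₁ null) = inj₁ (E-resp _ y′≈y null)
  Ok-resp X′≤X l′≗l y′≈y (inj₂ (a , b , a≢b , a≢τ , b≢τ , X≤)) = inj₂ (a , b , a≢b , a≢τ , b≢τ ,
    ≤-trans X′≤X (≤-trans X≤ (≤-reflexive (sym (cong₂ cost (l′≗l a a≢τ) (l′≗l b b≢τ))))))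

  Legal-resp : ∀ {δ l l′ y y′} → (∀ ρ → l′ ρ ≡ l ρ) → (∀ ρ → Null (y′ ρ ℤ.- y ρ)) →
               Legal δ l y → Legal δ l′ y′
  Legal-resp {δ} {l} {l′} {y} {y′} l′≗l y′≈y (hyper , bottom , top) =
      (λ (σ , above) → keep (λ _ → 1ℤ) (hyper (σ , λ ρ ρ≢σ →
         trans (sym (l′≗l σ)) (trans (above ρ ρ≢σ) (cong suc (l′≗l ρ))))))
    , (λ const → let Z , E₀ = bottom (const′ const) in keep _ Z , keep _ E₀)
    , (λ const → form-resp-− (λ _ → 1ℤ) y′≈y (top (const′ const)))
    where
    keep : ∀ c → Null (form c y) → Null (form c y′)
    keep c = form-resp c (λ ρ → null-* (c ρ) (y′≈y ρ))
    const′ : ∀ {d} → Const d l′ → Const d l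
    const′ const ρ = trans (sym (l′≗l ρ)) (const ρ)

  Legal-+ : ∀ {δ ε l y z} → Legal δ l y → Legal ε l z → Legal (δ ℤ.+ ε) l (λ ρ → y ρ ℤ.+ z ρ)
  Legal-+ {δ} {ε} {l} {y} {z} (hyper , bottom , top) (hyper′ , bottom′ , top′) =
      (λ h → add _ (hyper h) (hyper′ h))
    , (λ c → let Z , E₀ = bottom c; Z′ , E₀′ = bottom′ c in add _ Z Z′ , add _ E₀ E₀′)
    , (λ c → subst Null (trans (lemma (Z₁ y) δ (Z₁ z) ε) (cong (ℤ._- (δ ℤ.+ ε)) (sym (form-+ (λ _ → 1ℤ) y z))))
               (null-+ (top c) (top′ c)))
    where
    add : ∀ c → Null (form c y) → Null (form c z) → Null (form c (λ ρ → y ρ ℤ.+ z ρ))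
    add c null null′ = subst Null (sym (form-+ c y z)) (null-+ null null′)
    lemma : ∀ a b c d → (a ℤ.- b) ℤ.+ (c ℤ.- d) ≡ (a ℤ.+ c) ℤ.- (b ℤ.+ d)
    lemma = solve-∀

  Legal-neg : ∀ {δ l y} → Legal δ l y → Legal (ℤ.- δ) l (λ ρ → ℤ.- y ρ)
  Legal-neg {δ} {l} {y} (hyper , bottom , top) =
      (λ h → neg _ (hyper h))
    , (λ c → let Z , E₀ = bottom c in neg _ Z , neg _ E₀)
    , (λ c → subst Null (trans (lemma (Z₁ y) δ) (cong (ℤ._- (ℤ.- δ)) (sym (form-neg (λ _ → 1ℤ) y))))
               (null-neg (top c)))
    where
    neg : ∀ c → Null (form c y) → Null (form c (λ ρ → ℤ.- y ρ))
    neg c null = subst Null (sym (form-neg c y)) (null-neg null)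
    lemma : ∀ a b → ℤ.- (a ℤ.- b) ≡ (ℤ.- a) ℤ.- (ℤ.- b)
    lemma = solve-∀

  -- With one type raised above a common level `e`, every pair of types costs `2 ^ e`: two low ones
  -- as equal levels, the high one with a low one by the halved power of `suc e`. So the price does
  -- not depend on which types pay.
  hyper-dear : ∀ {X l} → Hyper l → ∀ {τ} → Dear X l τ → ∀ ρ → Dear X l ρ
  hyper-dear {X} {l} (σ , above) (a , b , a≢b , _ , _ , X≤) ρ =
    let c , c≢ρ , _ = third 3≤k ρ ρ
        d , d≢ρ , d≢c = third 3≤k ρ c
    in c , d , d≢c ∘ sym , c≢ρ , d≢ρ ,
       ≤-trans X≤ (≤-reflexive (trans (cost≡ a b a≢b) (sym (cost≡ c d (d≢c ∘ sym)))))
    where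
    other : ∃[ c ] c ≢ σ × c ≢ σ
    other = third 3≤k σ σ
    e = l (proj₁ other)
    lσ : l σ ≡ suc e
    lσ = above _ (proj₁ (proj₂ other))
    low : ∀ {ρ} → ρ ≢ σ → l ρ ≡ e
    low ρ≢σ = suc-injective (trans (sym (above _ ρ≢σ)) lσ)
    cost≡ : ∀ a b → a ≢ b → cost (l a) (l b) ≡ 2 ^ e
    cost≡ a b a≢b with a Fin.≟ σ | b Fin.≟ σ
    ... | yes refl | yes refl = contradiction refl a≢b
    ... | no a≢σ | no b≢σ = trans (cost-refl (trans (low a≢σ) (sym (low b≢σ)))) (cong (2 ^_) (low a≢σ))
    ... | yes refl | no b≢σ rewrite lσ | low b≢σ =
      trans (cost-≢ (1+n≢n)) (cong (λ m → 2 ^ pred m) (m≥n⇒m⊔n≡m (n≤1+n e)))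
    ... | no a≢σ | yes refl rewrite lσ | low a≢σ =
      trans (cost-≢ (1+n≢n ∘ sym)) (cong (λ m → 2 ^ pred m) (m≤n⇒m⊔n≡n (n≤1+n e)))

  -- Each value is acceptable at its own share of `X`, whereas `either` says that every single `E ρ`
  -- keeps the full `X` under one of the two. The latter is what remains once the pebble of type `ρ`
  -- is lifted.
  record Reply (X : ℕ) (δ : ℤ) (l : Fin k → ℕ) (τ : Fin k) (y : Fin k → ℤ) : Set where
    field
      d₁ d₂   : ℤ
      X₁ X₂   : ℕ
      share   : X ≤ X₁ + X₂
      ok₁     : ∀ ρ → Ok X₁ l ρ (y [ τ ↦ d₁ ])
      ok₂     : ∀ ρ → Ok X₂ l ρ (y [ τ ↦ d₂ ])
      legal₁  : Legal δ l (y [ τ ↦ d₁ ])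
      legal₂  : Legal δ l (y [ τ ↦ d₂ ])
      either  : ∀ ρ → Ok X l ρ (y [ τ ↦ d₁ ]) ⊎ Ok X l ρ (y [ τ ↦ d₂ ])

  one-reply : ∀ {X δ l τ y} d → (∀ ρ → Ok X l ρ (y [ τ ↦ d ])) → Legal δ l (y [ τ ↦ d ]) → Reply X δ l τ y
  one-reply {X} d ok legal = record
    { d₁ = d ; d₂ = d ; X₁ = X ; X₂ = X ; share = m≤m+n X X ; ok₁ = ok ; ok₂ = ok
    ; legal₁ = legal ; legal₂ = legal ; either = λ ρ → inj₁ (ok ρ) }

  reply : ∀ {X δ l τ y} → 2 ≤ X → X ≤ 2 ^ D → Ok X l τ y → Reply X δ l τ y
  reply {X} {δ} {l} {τ} {y} 2≤X X≤2^D okτ = go (Hyper? l) (Const? D l) okτ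
    where
    y⟨_⟩ : ℤ → Fin k → ℤ
    y⟨ d ⟩ = y [ τ ↦ d ]

    off : ∀ d ρ → ρ ≢ τ → Null (y⟨ d ⟩ ρ ℤ.- y ρ)
    off d ρ ρ≢τ = null-≡ (↦-off y ρ≢τ)

    1<⇒≰1 : ∀ {n} → X ≤ n → n ≡ 1 → ⊥
    1<⇒≰1 X≤n refl = <⇒≱ 2≤X X≤n

    hyper-¬const : ∀ {d} → Hyper l → ¬ Const d l
    hyper-¬const (σ , above) const = let c , c≢σ , _ = third 3≤k σ σ in
      1+n≢n (trans (sym (above c c≢σ)) (trans (const σ) (sym (const c))))

    solve : ∀ {c} → c ≢ τ → ℤ
    solve c≢τ = proj₁ (E-solve y c≢τ)

    solved : ∀ {c} (c≢τ : c ≢ τ) → Null (E c y⟨ solve c≢τ ⟩)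
    solved c≢τ = proj₂ (E-solve y c≢τ)

    solved-ok : ∀ {X′ c} (c≢τ : c ≢ τ) → (∀ e → X′ ≤ cost (l c) (l e)) → ∀ ρ → Ok X′ l ρ y⟨ solve c≢τ ⟩
    solved-ok {c = c} c≢τ X′≤ ρ with ρ Fin.≟ c
    ... | yes refl = inj₁ (solved c≢τ)
    ... | no  ρ≢c  = let e , e≢ρ , e≢c = third 3≤k ρ c in
      inj₂ (c , e , e≢c ∘ sym , ρ≢c ∘ sym , e≢ρ , X′≤ e)

    -- The price excludes the bottom law: at level 0 a pair costs only 1.
    free : ∀ {a b d} → ¬ Hyper l → ¬ Const D l → X ≤ cost (l a) (l b) → Legal δ l y⟨ d ⟩
    free {a} {b} ¬hyper ¬top X≤ =
        (λ h → contradiction h ¬hyper)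
      , (λ c → ⊥-elim (1<⇒≰1 X≤ (trans (cost-refl (trans (c a) (sym (c b)))) (cong (2 ^_) (c a)))))
      , (λ c → contradiction c ¬top)

    go : Dec (Hyper l) → Dec (Const D l) → Ok X l τ y → Reply X δ l τ y
    -- `Z₁ = 0` makes all `E` agree, so `E τ` decides for all of them: either it vanishes or its
    -- price serves everywhere.
    go (yes hyper) _ okτ = one-reply d ok
      ( (λ _ → Z₁0) , (λ c → contradiction c (hyper-¬const hyper)) , (λ c → contradiction c (hyper-¬const hyper)))
      where
      d = proj₁ (Z₁-solve y τ 0ℤ)
      Z₁0 : Null (Z₁ y⟨ d ⟩)
      Z₁0 = subst Null (ℤ.+-identityʳ _) (proj₂ (Z₁-solve y τ 0ℤ))
      ok : ∀ ρ → Ok X l ρ y⟨ d ⟩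
      ok ρ = [ (λ null → inj₁ (E-all {τ} ρ y⟨ d ⟩ Z₁0 (E-resp τ (off d) null)))
             , (λ dear → inj₂ (hyper-dear hyper dear ρ)) ]′ okτ
    -- At the top every pair costs `2 ^ D`, which is at least `X`, so all `E` may become nonzero
    -- when `Z₁` is set to `δ`.
    go (no ¬hyper) (yes const) _ = one-reply d (λ ρ → inj₂ (dear ρ))
      ( (λ h → contradiction h ¬hyper)
      , (λ c → ⊥-elim (1<⇒≰1 X≤2^D (cong (2 ^_) (trans (sym (const τ)) (c τ)))))
      , (λ _ → proj₂ (Z₁-solve y τ δ)))
      where
      d = proj₁ (Z₁-solve y τ δ)
      dear : ∀ ρ → Dear X l ρ
      dear ρ = let a , a≢ρ , _ = third 3≤k ρ ρ
                   b , b≢ρ , b≢a = third 3≤k ρ a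
               in a , b , b≢a ∘ sym , a≢ρ , b≢ρ ,
                  ≤-trans X≤2^D (≤-reflexive (sym (trans (cost-refl (trans (const a) (sym (const b)))) (cong (2 ^_) (const a)))))
    go (no ¬hyper) (no ¬top) (inj₁ null) = one-reply d (λ ρ → inj₁ (null′ ρ))
      ( (λ h → contradiction h ¬hyper) , (λ _ → Z₁0 , null′ o) , (λ c → contradiction c ¬top))
      where
      d = proj₁ (Z₁-solve y τ 0ℤ)
      Z₁0 : Null (Z₁ y⟨ d ⟩)
      Z₁0 = subst Null (ℤ.+-identityʳ _) (proj₂ (Z₁-solve y τ 0ℤ))
      null′ : ∀ ρ → Null (E ρ y⟨ d ⟩)
      null′ ρ = E-all {τ} ρ y⟨ d ⟩ Z₁0 (E-resp τ (off d) null)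
    -- No law is in force. At unequal levels `E` of the higher type is annulled, and that type makes
    -- every other `E` dear enough. At equal levels annulling `E a` or `E b` secures only half of
    -- `2 ^ l a`, so two answers are needed.
    go (no ¬hyper) (no ¬top) (inj₂ (a , b , a≢b , a≢τ , b≢τ , X≤)) with <-cmp (l a) (l b)
    ... | tri< la<lb _ _ = one-reply (solve b≢τ) (solved-ok b≢τ (λ e → ≤-trans X≤ (≤-trans (≤-reflexive
            (trans (cost-≢ (<⇒≢ la<lb)) (cong (λ m → 2 ^ pred m) (m≤n⇒m⊔n≡n (<⇒≤ la<lb)))))
            (cost-lower (l b) (l e))))) (free ¬hyper ¬top X≤)
    ... | tri> _ _ lb<la = one-reply (solve a≢τ) (solved-ok a≢τ (λ e → ≤-trans X≤ (≤-trans (≤-reflexive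
            (trans (cost-≢ (<⇒≢ lb<la ∘ sym)) (cong (λ m → 2 ^ pred m) (m≥n⇒m⊔n≡m (<⇒≤ lb<la)))))
            (cost-lower (l a) (l e))))) (free ¬hyper ¬top X≤)
    ... | tri≈ _ la≡lb _ = record
      { d₁ = solve a≢τ ; d₂ = solve b≢τ
      ; X₁ = 2 ^ pred (l a) ; X₂ = 2 ^ pred (l a)
      ; share  = ≤-trans X≤2^la (≤-reflexive (2^-double 0<la))
      ; ok₁    = solved-ok a≢τ (λ e → cost-lower (l a) (l e))
      ; ok₂    = solved-ok b≢τ (λ e → ≤-trans (≤-reflexive (cong (λ m → 2 ^ pred m) la≡lb)) (cost-lower (l b) (l e)))
      ; legal₁ = free ¬hyper ¬top X≤
      ; legal₂ = free ¬hyper ¬top X≤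
      ; either = either }
      where
      X≤2^la : X ≤ 2 ^ l a
      X≤2^la = ≤-trans X≤ (≤-reflexive (cost-refl la≡lb))
      0<la : 0 < l a
      0<la = n≢0⇒n>0 (λ la≡0 → 1<⇒≰1 X≤2^la (cong (2 ^_) la≡0))
      either : ∀ ρ → Ok X l ρ y⟨ solve a≢τ ⟩ ⊎ Ok X l ρ y⟨ solve b≢τ ⟩
      either ρ with ρ Fin.≟ a | ρ Fin.≟ b
      ... | yes refl | _ = inj₁ (inj₁ (solved a≢τ))
      ... | no _ | yes refl = inj₂ (inj₁ (solved b≢τ))
      -- Away from `a` and `b` the old pair still pays the full price.
      ... | no ρ≢a | no ρ≢b = inj₁ (inj₂ (a , b , a≢b , ρ≢a ∘ sym , ρ≢b ∘ sym , X≤))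

-- Pigeonhole principles.

injective⇒surjective : ∀ {n} (f : Fin n → Fin n) → (∀ {x y} → f x ≡ f y → x ≡ y) → ∀ m → ∃[ x ] f x ≡ m
injective⇒surjective {suc n} f inj m with Fin.any? (λ x → f x Fin.≟ m)
... | yes hit = hit
... | no miss = contradiction
  (Fin.injective⇒≤ {f = λ x → Fin.punchOut (m≢f x)} (λ {x} {y} eq →
    inj (Fin.punchOut-injective (m≢f x) (m≢f y) eq)))
  1+n≰n
  where
  m≢f : ∀ x → m ≢ f x
  m≢f x m≡fx = miss (x , sym m≡fx)

-- Were every value hit, a section of `f` would be injective, hence onto, and `f` would be its
-- inverse.
missed : ∀ {n} (f : Fin n → Fin n) {a b} → a ≢ b → f a ≡ f b → ∃[ m ] (∀ x → f x ≢ m)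
missed f {a} {b} a≢b fa≡fb with Fin.any? (λ m → Fin.all? (λ x → ¬? (f x Fin.≟ m)))
... | yes miss = miss
... | no  hit  = contradiction a≡b a≢b
  where
  section : ∀ m → ∃[ x ] f x ≡ m
  section m with Fin.any? (λ x → f x Fin.≟ m)
  ... | yes hit = hit
  ... | no miss = contradiction (m , λ x fx≡m → miss (x , fx≡m)) hit
  g = proj₁ ∘ section
  fg : ∀ m → f (g m) ≡ m
  fg = proj₂ ∘ section
  g-surjective = injective⇒surjective g (λ {x} {y} eq → trans (sym (fg x)) (trans (cong f eq) (fg y)))
  value : ∀ {x} (s : ∃[ m ] g m ≡ x) → f x ≡ proj₁ s
  value (m , refl) = fg m
  a≡b : a ≡ b
  a≡b = let u = g-surjective a ; v = g-surjective b in
    trans (sym (proj₂ u)) (trans (cong g (trans (sym (value u)) (trans fa≡fb (value v)))) (proj₂ v))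

-- Duplicator's answer at an arbitrary pebbling.

module Pebbles (k : ℕ) (3≤k : 3 ≤ k) (D : ℕ) (typ : Fin k → Maybe (Fin k)) (lev : Fin k → ℕ) where

  open Levels k 3≤k D

  Pattern : (Fin k → Set) → Fin k → (Fin k → Fin k) → Set
  Pattern on τ p = ∀ ρ → ρ ≢ τ → on (p ρ) × typ (p ρ) ≡ just ρ

  -- What Duplicator maintains against attacks of cost below X, where the pebble
  -- at m has been moved by z m in passing from one structure to the other and
  -- only the pebbles satisfying 'on' are considered.
  record Facts (on : Fin k → Set) (X : ℕ) (z : Fin k → ℤ) : Set where
    field
      flat : ∀ {j j′ σ} → on j → on j′ → typ j ≡ just σ → typ j′ ≡ just σ →
             Null (z j ℤ.- z j′) ⊎ X ≤ hop (lev j) (lev j′)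
      line : ∀ τ p → Pattern on τ p → Ok X (lev ∘ p) τ (z ∘ p)

  -- Shifts obey the difference of the two systems of equations, so `δ` stands for the difference of
  -- their constants.
  Lawful : ℤ → (Fin k → ℤ) → Set
  Lawful δ z = ∀ p → (∀ ρ → typ (p ρ) ≡ just ρ) → Legal δ (lev ∘ p) (z ∘ p)

  Safe : ℕ → ℤ → (Fin k → ℤ) → Set
  Safe X δ z = Facts (λ _ → ⊤) X z × Lawful δ z

  Facts-weaken : ∀ {on on′ X X′ z} → (∀ {m} → on′ m → on m) → X′ ≤ X → Facts on X z → Facts on′ X′ z
  Facts-weaken {z = z} on′⇒on X′≤X F = record
    { flat = λ oj oj′ tj tj′ → [ inj₁ , inj₂ ∘ ≤-trans X′≤X ]′ (flat (on′⇒on oj) (on′⇒on oj′) tj tj′)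
    ; line = λ τ p pat → Ok-resp X′≤X (λ _ _ → refl) (λ ρ _ → null-≡ {z (p ρ)} refl)
                (line τ p (λ ρ ρ≢τ → let o , t = pat ρ ρ≢τ in on′⇒on o , t)) }
    where open Facts F

  -- The counterpart of `Reply` for pebblings: whichever pebble `m` is lifted next, one of the two
  -- answers retains the full `X`.
  record Response (X : ℕ) (δ : ℤ) (i : Fin k) (z : Fin k → ℤ) : Set where
    field
      d₁ d₂  : ℤ
      X₁ X₂  : ℕ
      share  : X ≤ X₁ + X₂
      safe₁  : Safe X₁ δ (z [ i ↦ d₁ ])
      safe₂  : Safe X₂ δ (z [ i ↦ d₂ ])
      either : ∀ m → Facts (_≢ m) X (z [ i ↦ d₁ ]) ⊎ Facts (_≢ m) X (z [ i ↦ d₂ ])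

  one-response : ∀ {X δ i z} d → Safe X δ (z [ i ↦ d ]) → Response X δ i z
  one-response {X} d safe = record
    { d₁ = d ; d₂ = d ; X₁ = X ; X₂ = X ; share = m≤m+n X X ; safe₁ = safe ; safe₂ = safe
    ; either = λ _ → inj₁ (Facts-weaken (λ _ → tt) ≤-refl (proj₁ safe)) }

  type-unique : ∀ {m m′ ρ ρ′} → m ≡ m′ → typ m ≡ just ρ → typ m′ ≡ just ρ′ → ρ ≡ ρ′
  type-unique refl tm tm′ = Maybe.just-injective (trans (sym tm) tm′)

  full-surjective : ∀ p → (∀ ρ → typ (p ρ) ≡ just ρ) → ∀ m → ∃[ ρ ] p ρ ≡ m
  full-surjective p full = injective⇒surjective p (λ {x} {y} eq → type-unique eq (full x) (full y))

  module Respond {X : ℕ} {δ : ℤ} {i : Fin k} {z : Fin k → ℤ} (2≤X : 2 ≤ X) (X≤2^D : X ≤ 2 ^ D) (known : Facts (_≢ i) X z) where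

    open Facts known

    z⟨_⟩ : ℤ → Fin k → ℤ
    z⟨ d ⟩ = z [ i ↦ d ]

    flat-↦ : ∀ (on : Fin k → Set) {X′ d} → X′ ≤ X →
      (∀ {j σ} → on i → on j → j ≢ i → typ i ≡ just σ → typ j ≡ just σ →
        Null (d ℤ.- z j) ⊎ X′ ≤ hop (lev i) (lev j)) →
      ∀ {j j′ σ} → on j → on j′ → typ j ≡ just σ → typ j′ ≡ just σ →
        Null (z⟨ d ⟩ j ℤ.- z⟨ d ⟩ j′) ⊎ X′ ≤ hop (lev j) (lev j′)
    flat-↦ on {d = d} X′≤X new {j} {j′} oj oj′ tj tj′ with j Fin.≟ i | j′ Fin.≟ i
    ... | yes refl | yes refl = inj₁ (null-≡ {d} refl)
    ... | yes refl | no j′≢i = new oj oj′ j′≢i tj tj′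
    ... | no j≢i | no j′≢i = [ inj₁ , inj₂ ∘ ≤-trans X′≤X ]′ (flat j≢i j′≢i tj tj′)
    ... | no j≢i | yes refl with new oj′ oj j≢i tj′ tj
    ...   | inj₁ null = inj₁ (subst Null (lemma d (z j)) (null-neg null))
      where
      lemma : ∀ a b → ℤ.- (a ℤ.- b) ≡ b ℤ.- a
      lemma = solve-∀
    ...   | inj₂ X′≤ = inj₂ (≤-trans X′≤ (≤-reflexive (hop-sym (lev i) (lev j))))

    line-old : ∀ {X′ d} τ p → X′ ≤ X → (∀ ρ → ρ ≢ τ → p ρ ≢ i × typ (p ρ) ≡ just ρ) →
               Ok X′ (lev ∘ p) τ (z⟨ d ⟩ ∘ p)
    line-old {d = d} τ p X′≤X pat = Ok-resp X′≤X (λ _ _ → refl)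
      (λ ρ ρ≢τ → null-≡ (↦-off z {d = d} (proj₁ (pat ρ ρ≢τ)))) (line τ p pat)

    respond-untyped : typ i ≡ nothing → Response X δ i z
    respond-untyped ti = one-response 0ℤ
      ( record
        { flat = flat-↦ (λ _ → ⊤) ≤-refl (λ _ _ _ ti′ _ → contradiction (trans (sym ti) ti′) λ())
        ; line = λ τ p pat → line-old τ p ≤-refl (λ ρ ρ≢τ → typed (proj₂ (pat ρ ρ≢τ)) , proj₂ (pat ρ ρ≢τ)) }
      , λ p full → let ρ , pρ≡i = full-surjective p full i in contradiction pρ≡i (typed (full ρ)) )
      where
      typed : ∀ {m ρ} → typ m ≡ just ρ → m ≢ i
      typed tm refl = contradiction (trans (sym ti) tm) λ()

    module Typed {τ : Fin k} (ti : typ i ≡ just τ) where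

      -- Expresses that some pattern can pass through `i`.
      Covered : Set
      Covered = ∃[ τ′ ] τ′ ≢ τ × (∀ ρ → ρ ≢ τ → ρ ≢ τ′ → ∃[ m ] m ≢ i × typ m ≡ just ρ)

      covered? : Dec Covered
      covered? = Fin.any? λ τ′ → ¬? (τ′ Fin.≟ τ) ×-dec
        Fin.all? λ ρ → ¬? (ρ Fin.≟ τ) →-dec ¬? (ρ Fin.≟ τ′) →-dec
          Fin.any? λ m → ¬? (m Fin.≟ i) ×-dec Maybe.≡-dec Fin._≟_ (typ m) (just ρ)

      avoid : ∀ {m ρ} → typ m ≡ just ρ → ρ ≢ τ → m ≢ i
      avoid tm ρ≢τ m≡i = ρ≢τ (type-unique m≡i tm ti)

      pattern-covers : ∀ τ′ p {on : Fin k → Set} → τ′ ≢ τ → Pattern on τ′ p → Covered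
      pattern-covers τ′ p τ′≢τ pat = τ′ , τ′≢τ , λ ρ ρ≢τ ρ≢τ′ →
        let tρ = proj₂ (pat ρ ρ≢τ′) in p ρ , avoid tρ ρ≢τ , tρ

      full-covers : ∀ p → (∀ ρ → typ (p ρ) ≡ just ρ) → Covered
      full-covers p full = let τ′ , τ′≢τ , _ = third 3≤k τ τ in
        pattern-covers τ′ p {λ _ → ⊤} τ′≢τ (λ ρ _ → tt , full ρ)

      flat-new : ∀ (on : Fin k → Set) {X′ d} → X′ ≤ X →
        (∀ {j} → on j → j ≢ i → typ j ≡ just τ → Null (d ℤ.- z j) ⊎ X′ ≤ hop (lev i) (lev j)) →
        ∀ {j j′ σ} → on j → on j′ → typ j ≡ just σ → typ j′ ≡ just σ →
          Null (z⟨ d ⟩ j ℤ.- z⟨ d ⟩ j′) ⊎ X′ ≤ hop (lev j) (lev j′)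
      flat-new on X′≤X new = flat-↦ on X′≤X λ _ oj j≢i ti′ tj → new oj j≢i (trans tj (trans (sym ti′) ti))

      -- No pattern needs `i`, so only pebbles of the same type matter. Duplicator copies one whose
      -- `hop` from `i` is below `X`, if there is one; the ultrametric inequality settles the
      -- others.
      respond-uncovered : ¬ Covered → Response X δ i z
      respond-uncovered uncovered =
        reply-near (Fin.any? (λ j → ¬? (j Fin.≟ i)
          ×-dec Maybe.≡-dec Fin._≟_ (typ j) (just τ) ×-dec (hop (lev i) (lev j) <? X)))
        where
        reply-with : ∀ d → (∀ {j} → j ≢ i → typ j ≡ just τ → Null (d ℤ.- z j) ⊎ X ≤ hop (lev i) (lev j)) →
                     Response X δ i z
        reply-with d new = one-response d
          ( record { flat = flat-new (λ _ → ⊤) ≤-refl (λ _ → new) ; line = line′ }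
          , λ p full → contradiction (full-covers p full) uncovered)
          where
          line′ : ∀ τ′ p → Pattern (λ _ → ⊤) τ′ p → Ok X (lev ∘ p) τ′ (z⟨ d ⟩ ∘ p)
          line′ τ′ p pat with τ′ Fin.≟ τ
          ... | yes refl = line-old τ′ p ≤-refl (λ ρ ρ≢τ → let tρ = proj₂ (pat ρ ρ≢τ) in avoid tρ ρ≢τ , tρ)
          ... | no τ′≢τ = contradiction (pattern-covers τ′ p {λ _ → ⊤} τ′≢τ pat) uncovered

        Near : Fin k → Set
        Near j = j ≢ i × typ j ≡ just τ × hop (lev i) (lev j) < X

        reply-near : Dec (∃ Near) → Response X δ i z
        reply-near (no far) = reply-with 0ℤ λ j≢i tj → inj₂ (≮⇒≥ λ near → far (_ , j≢i , tj , near))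
        reply-near (yes (j , j≢i , tj , near)) = reply-with (z j) λ j′≢i tj′ →
          case flat j≢i j′≢i tj tj′ of λ where
            (inj₁ null) → inj₁ null
            (inj₂ X≤) → case hop-ultra (lev j) (lev i) _ X≤ of λ where
              (inj₁ X≤′) → contradiction (≤-trans X≤′ (≤-reflexive (hop-sym (lev j) (lev i)))) (<⇒≱ near)
              (inj₂ X≤′) → inj₂ X≤′

      -- The pebbles f ρ show all types except possibly τ′, and no others are left.
      module Cover {τ′ : Fin k} (f : Fin k → Fin k) (τ′≢τ : τ′ ≢ τ) (hits : ∀ m → ∃[ ρ ] f ρ ≡ m)
                   (fτ : f τ ≡ i) (tf : ∀ ρ → ρ ≢ τ′ → typ (f ρ) ≡ just ρ) (fτ′≢i : f τ′ ≢ i) where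

        j : Fin k
        j = f τ′

        located : ∀ {m ρ} → typ m ≡ just ρ → m ≡ f ρ ⊎ m ≡ j
        located {m} tm with hits m
        ... | x , fx≡m with x Fin.≟ τ′
        ...   | yes refl  = inj₂ (sym fx≡m)
        ...   | no  x≢τ′ with refl ← type-unique fx≡m (tf x x≢τ′) tm = inj₁ (sym fx≡m)

        only-j : ∀ {m} → m ≢ i → typ m ≡ just τ → m ≡ j
        only-j m≢i tm = [ (λ m≡fτ → contradiction (trans m≡fτ fτ) m≢i) , id ]′ (located tm)

        f≢i : ∀ {ρ} → ρ ≢ τ → f ρ ≢ i
        f≢i {ρ} ρ≢τ with ρ Fin.≟ τ′
        ... | yes refl = fτ′≢i
        ... | no ρ≢τ′  = avoid (tf ρ ρ≢τ′) ρ≢τ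

        moved : ∀ (q : Fin k → Fin k) d → q τ ≡ i → ∀ {x} → (x ≢ τ → q x ≢ i) →
                z⟨ d ⟩ (q x) ≡ ((z ∘ q) [ τ ↦ d ]) x
        moved q d qτ≡i {x} q≢i with x Fin.≟ τ
        ... | yes refl = ↦-at z qτ≡i
        ... | no  x≢τ  = ↦-off z (q≢i x≢τ)

        module Rainbow (tj : typ j ≡ just τ′) where

          full : ∀ ρ → typ (f ρ) ≡ just ρ
          full ρ with ρ Fin.≟ τ′
          ... | yes refl = tj
          ... | no ρ≢τ′  = tf ρ ρ≢τ′

          unique : ∀ {m ρ} → typ m ≡ just ρ → m ≡ f ρ
          unique tm with located tm
          ... | inj₁ m≡fρ = m≡fρ
          ... | inj₂ m≡j with refl ← type-unique m≡j tm tj = m≡j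

          open Reply (reply {δ = δ} 2≤X X≤2^D (line τ f λ ρ ρ≢τ → f≢i ρ≢τ , full ρ)) renaming (either to either′)

          ok-pattern : ∀ {X′ d} ρ p → (∀ x → x ≢ ρ → typ (p x) ≡ just x) →
                       Ok X′ (lev ∘ f) ρ ((z ∘ f) [ τ ↦ d ]) → Ok X′ (lev ∘ p) ρ (z⟨ d ⟩ ∘ p)
          ok-pattern {d = d} ρ p pat = Ok-resp ≤-refl
            (λ x x≢ρ → cong lev (unique (pat x x≢ρ)))
            (λ x x≢ρ → null-≡ {z⟨ d ⟩ (p x)} (trans (cong z⟨ d ⟩ (unique (pat x x≢ρ))) (moved f d fτ f≢i)))

          flat-rainbow : ∀ (on : Fin k → Set) {X′ d j j′ σ} → on j → on j′ → typ j ≡ just σ → typ j′ ≡ just σ →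
                         Null (z⟨ d ⟩ j ℤ.- z⟨ d ⟩ j′) ⊎ X′ ≤ hop (lev j) (lev j′)
          flat-rainbow on {d = d} {j} _ _ tj tj′ = inj₁ (null-≡ {z⟨ d ⟩ j} (cong z⟨ d ⟩ (trans (unique tj) (sym (unique tj′)))))

          safe : ∀ {X′ d} → (∀ ρ → Ok X′ (lev ∘ f) ρ ((z ∘ f) [ τ ↦ d ])) →
                 Legal δ (lev ∘ f) ((z ∘ f) [ τ ↦ d ]) → Safe X′ δ z⟨ d ⟩
          safe {d = d} ok legal =
              record { flat = flat-rainbow (λ _ → ⊤) {d = d}
                     ; line = λ ρ p pat → ok-pattern ρ p (λ x x≢ρ → proj₂ (pat x x≢ρ)) (ok ρ) }
            , λ p fullp → Legal-resp (λ ρ → cong lev (unique (fullp ρ)))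
                (λ ρ → null-≡ {z⟨ d ⟩ (p ρ)} (trans (cong z⟨ d ⟩ (unique (fullp ρ))) (moved f d fτ f≢i))) legal

          -- Without the only pebble of type `ρ`, all remaining patterns omit `ρ`, so a single `Ok`
          -- suffices.
          facts : ∀ {d} m → (∃[ ρ ] f ρ ≡ m × Ok X (lev ∘ f) ρ ((z ∘ f) [ τ ↦ d ])) → Facts (_≢ m) X z⟨ d ⟩
          facts {d} m (ρ , fρ≡m , ok) = record { flat = flat-rainbow (_≢ m) {d = d} ; line = line′ }
            where
            line′ : ∀ ρ′ p → Pattern (_≢ m) ρ′ p → Ok X (lev ∘ p) ρ′ (z⟨ d ⟩ ∘ p)
            line′ ρ′ p pat with ρ Fin.≟ ρ′
            ... | yes refl = ok-pattern ρ p (λ x x≢ρ → proj₂ (pat x x≢ρ)) ok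
            ... | no  ρ≢ρ′ = let pρ≢m , tpρ = pat ρ ρ≢ρ′ in
              contradiction (trans (unique tpρ) fρ≡m) pρ≢m

          response : Response X δ i z
          response = record
            { d₁ = d₁ ; d₂ = d₂ ; X₁ = X₁ ; X₂ = X₂ ; share = share
            ; safe₁ = safe ok₁ legal₁ ; safe₂ = safe ok₂ legal₂
            ; either = λ m → let ρ , fρ≡m = hits m in
                [ (λ ok → inj₁ (facts m (ρ , fρ≡m , ok))) , (λ ok → inj₂ (facts m (ρ , fρ≡m , ok))) ]′ (either′ ρ) }

        module Defective (tj≢τ′ : typ j ≢ just τ′) where

          absent : ∀ m → typ m ≢ just τ′
          absent m tm with located tm
          ... | inj₁ refl = tj≢τ′ tm
          ... | inj₂ refl = tj≢τ′ tm

          lawful : ∀ {d} → Lawful δ z⟨ d ⟩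
          lawful p full = contradiction (full τ′) (absent (p τ′))

          line-τ′ : ∀ (on : Fin k → Set) {X′} d → (∀ p → Pattern on τ′ p → Ok X′ (lev ∘ p) τ′ (z⟨ d ⟩ ∘ p)) →
                    ∀ ρ p → Pattern on ρ p → Ok X′ (lev ∘ p) ρ (z⟨ d ⟩ ∘ p)
          line-τ′ on d line ρ p pat with τ′ Fin.≟ ρ
          ... | yes refl = line p pat
          ... | no τ′≢ρ  = contradiction (proj₂ (pat τ′ τ′≢ρ)) (absent (p τ′))

          module Twin (tj : typ j ≡ just τ) where

            elsewhere : ∀ {m x} → typ m ≡ just x → x ≢ τ → m ≡ f x
            elsewhere tm x≢τ = [ id , (λ m≡j → contradiction (type-unique m≡j tm tj) x≢τ) ]′ (located tm)

            P : Fin k → Fin k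
            P = f [ τ ↦ j ]

            P-pattern : Pattern (_≢ i) τ′ P
            P-pattern x x≢τ′ with x Fin.≟ τ
            ... | yes refl = fτ′≢i , tj
            ... | no  x≢τ  = f≢i x≢τ , tf x x≢τ′

            at-τ : ∀ {m} → typ m ≡ just τ → m ≡ i ⊎ m ≡ j
            at-τ tm = [ (λ m≡fτ → inj₁ (trans m≡fτ fτ)) , inj₂ ]′ (located tm)

            -- Once `i` carries the shift of `j`, it makes no difference to the values which twin a
            -- pattern uses.
            follow : ∀ (on : Fin k → Set) p {x} → Pattern on τ′ p → x ≢ τ′ → z⟨ z j ⟩ (p x) ≡ z (P x)
            follow on p {x} pat x≢τ′ with x Fin.≟ τ
            ... | no  x≢τ  = trans (↦-off z (avoid (proj₂ (pat x x≢τ′)) x≢τ)) (cong z (elsewhere (proj₂ (pat x x≢τ′)) x≢τ))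
            ... | yes refl with at-τ (proj₂ (pat x x≢τ′))
            ...   | inj₁ px≡i = ↦-at z px≡i
            ...   | inj₂ px≡j = trans (↦-off z (λ px≡i → fτ′≢i (trans (sym px≡j) px≡i))) (cong z px≡j)

            flat-follow : ∀ (on : Fin k → Set) {X′} → X′ ≤ X → ∀ {m m′ σ} → on m → on m′ → typ m ≡ just σ → typ m′ ≡ just σ →
                          Null (z⟨ z j ⟩ m ℤ.- z⟨ z j ⟩ m′) ⊎ X′ ≤ hop (lev m) (lev m′)
            flat-follow on X′≤X = flat-new on X′≤X λ _ m≢i tm → inj₁ (null-≡ {z j} (cong z (sym (only-j m≢i tm))))

            follow-response : (∀ p → Pattern (λ _ → ⊤) τ′ p → Ok X (lev ∘ p) τ′ (z⟨ z j ⟩ ∘ p)) → Response X δ i z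
            follow-response line = one-response (z j)
              ( record { flat = flat-follow (λ _ → ⊤) ≤-refl ; line = line-τ′ (λ _ → ⊤) (z j) line } , lawful )

            -- Duplicator either restores the equation through i or lets i follow
            -- its twin j; the triangle inequality splits the cost.
            module Split {b : Fin k} (b≢τ : b ≢ τ) (b≢τ′ : b ≢ τ′) (X≤ : X ≤ cost (lev j) (lev (f b))) where

              d : ℤ
              d = proj₁ (E-solve (z ∘ f) τ′≢τ)

              dear : ∀ {on : Fin k → Set} {X′ m} p → Pattern on τ′ p → p τ ≡ m → X′ ≤ cost (lev m) (lev (f b)) →
                     Dear X′ (lev ∘ p) τ′
              dear p pat refl X′≤ = τ , b , b≢τ ∘ sym , τ′≢τ ∘ sym , b≢τ′ ,
                ≤-trans X′≤ (≤-reflexive (cong (cost _ ∘ lev) (sym (elsewhere (proj₂ (pat b b≢τ′)) b≢τ))))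

              restored : ∀ {on : Fin k → Set} p → Pattern on τ′ p → p τ ≡ i → Null (E τ′ (z⟨ d ⟩ ∘ p))
              restored p pat pτ≡i = E-resp τ′ (λ x x≢τ′ → null-≡ {z⟨ d ⟩ (p x)}
                  (trans (cong z⟨ d ⟩ (px≡fx x x≢τ′)) (moved f d fτ f≢i)))
                (proj₂ (E-solve (z ∘ f) τ′≢τ))
                where
                px≡fx : ∀ x → x ≢ τ′ → p x ≡ f x
                px≡fx x x≢τ′ with x Fin.≟ τ
                ... | yes refl = trans pτ≡i (sym fτ)
                ... | no  x≢τ  = elsewhere (proj₂ (pat x x≢τ′)) x≢τ

              line-restore : ∀ {X′} → X′ ≤ X → ∀ p → Pattern (λ _ → ⊤) τ′ p → Ok X′ (lev ∘ p) τ′ (z⟨ d ⟩ ∘ p)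
              line-restore X′≤X p pat with at-τ (proj₂ (pat τ (τ′≢τ ∘ sym)))
              ... | inj₁ pτ≡i = inj₁ (restored p pat pτ≡i)
              ... | inj₂ pτ≡j = inj₂ (dear p pat pτ≡j (≤-trans X′≤X X≤))

              line-follow : ∀ {X′} → X′ ≤ X → X′ ≤ cost (lev i) (lev (f b)) →
                            ∀ p → Pattern (λ _ → ⊤) τ′ p → Ok X′ (lev ∘ p) τ′ (z⟨ z j ⟩ ∘ p)
              line-follow X′≤X X′≤ p pat with at-τ (proj₂ (pat τ (τ′≢τ ∘ sym)))
              ... | inj₁ pτ≡i = inj₂ (dear p pat pτ≡i X′≤)
              ... | inj₂ pτ≡j = inj₂ (dear p pat pτ≡j (≤-trans X′≤X X≤))

              -- A pattern through `i` uses every pebble but `j`. If another pebble is lifted, the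
              -- pattern must pass through `j`, where the full price is known.
              lifted : ∀ m → m ≢ j → ∀ p → Pattern (_≢ m) τ′ p → p τ ≡ j
              lifted m m≢j p pat with at-τ (proj₂ (pat τ (τ′≢τ ∘ sym)))
              ... | inj₂ pτ≡j = pτ≡j
              ... | inj₁ pτ≡i with hits m
              ...   | ρ , fρ≡m with ρ Fin.≟ τ | ρ Fin.≟ τ′
              ...     | _ | yes refl = contradiction (sym fρ≡m) m≢j
              ...     | yes refl | _ = contradiction (trans pτ≡i (trans (sym fτ) fρ≡m)) (proj₁ (pat τ (τ′≢τ ∘ sym)))
              ...     | no ρ≢τ | no ρ≢τ′ = contradiction (trans (elsewhere (proj₂ (pat ρ ρ≢τ′)) ρ≢τ) fρ≡m) (proj₁ (pat ρ ρ≢τ′))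

              response : Response X δ i z
              response = record
                { d₁ = d ; d₂ = z j
                ; X₁ = X ⊓ hop (lev j) (lev i)
                ; X₂ = X ⊓ cost (lev i) (lev (f b))
                ; share = ≤+⇒≤⊓+⊓ _ _ (≤-trans X≤ (cost-triangle (lev j) (lev i) (lev (f b))))
                ; safe₁ = record
                    { flat = flat-new (λ _ → ⊤) (m⊓n≤m X _) λ _ m≢i tm → inj₂ (≤-trans (m⊓n≤n X _) (≤-reflexive
                        (trans (hop-sym (lev j) (lev i)) (cong (hop (lev i) ∘ lev) (sym (only-j m≢i tm))))))
                    ; line = line-τ′ (λ _ → ⊤) d (line-restore (m⊓n≤m X _)) } , lawful
                ; safe₂ = record
                    { flat = flat-follow (λ _ → ⊤) (m⊓n≤m X _)
                    ; line = line-τ′ (λ _ → ⊤) (z j) (line-follow (m⊓n≤m X _) (m⊓n≤n X _)) } , lawful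
                ; either = either }
                where
                either : ∀ m → Facts (_≢ m) X z⟨ d ⟩ ⊎ Facts (_≢ m) X z⟨ z j ⟩
                either m with m Fin.≟ j
                -- With `j` lifted only `i` represents `τ`, and the equation through `i` has been
                -- restored.
                ... | yes refl = inj₁ record
                  { flat = flat-new (_≢ m) ≤-refl (λ m′≢j m′≢i tm′ → contradiction (only-j m′≢i tm′) m′≢j)
                  ; line = line-τ′ (_≢ m) d λ p pat →
                      [ (λ pτ≡i → inj₁ (restored {_≢ m} p pat pτ≡i))
                      , (λ pτ≡j → contradiction pτ≡j (proj₁ (pat τ (τ′≢τ ∘ sym)))) ]′
                      (at-τ (proj₂ (pat τ (τ′≢τ ∘ sym)))) }
                ... | no m≢j = inj₂ record
                  { flat = flat-follow (_≢ m) ≤-refl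
                  ; line = line-τ′ (_≢ m) (z j) λ p pat → inj₂ (dear {_≢ m} p pat (lifted m m≢j p pat) X≤) }

            response : Response X δ i z
            response with line τ′ P P-pattern
            ... | inj₁ null = follow-response λ p pat → inj₁ (E-resp τ′
                    (λ x x≢τ′ → null-≡ {z⟨ z j ⟩ (p x)} (follow (λ _ → ⊤) p pat x≢τ′)) null)
            -- If `j` is one of the paying pebbles, a pattern through `i` need not be dear enough;
            -- only then is the answer split.
            ... | inj₂ (a , b , a≢b , a≢τ′ , b≢τ′ , X≤) with a Fin.≟ τ | b Fin.≟ τ
            ...   | yes refl | yes refl = contradiction refl a≢b
            ...   | yes refl | no b≢τ = Split.response b≢τ b≢τ′ X≤
            ...   | no a≢τ | yes refl = Split.response a≢τ a≢τ′ (≤-trans X≤ (≤-reflexive (cost-sym (lev (f a)) (lev j))))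
            ...   | no a≢τ | no b≢τ = follow-response λ p pat → inj₂ (a , b , a≢b , a≢τ′ , b≢τ′ ,
                    ≤-trans X≤ (≤-reflexive (cong₂ (λ u v → cost (lev u) (lev v))
                      (sym (elsewhere (proj₂ (pat a a≢τ′)) a≢τ)) (sym (elsewhere (proj₂ (pat b b≢τ′)) b≢τ)))))

          module Other (tj≢τ : typ j ≢ just τ) where

            line-response : ∀ d → (∀ p → Pattern (λ _ → ⊤) τ′ p → Ok X (lev ∘ p) τ′ (z⟨ d ⟩ ∘ p)) → Response X δ i z
            line-response d line = one-response d
              ( record { flat = flat-new (λ _ → ⊤) ≤-refl λ _ m≢i tm →
                           contradiction (trans (cong typ (sym (only-j m≢i tm))) tm) tj≢τ
                       ; line = line-τ′ (λ _ → ⊤) d line } , lawful )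

            at-τ : ∀ {m} → typ m ≡ just τ → m ≡ i
            at-τ tm with located tm
            ... | inj₁ m≡fτ = trans m≡fτ fτ
            ... | inj₂ refl = contradiction tm tj≢τ

            response-untyped : typ j ≡ nothing → Response X δ i z
            response-untyped tj = line-response d λ p pat → inj₁ (E-resp τ′ (λ x x≢τ′ → null-≡ {z⟨ d ⟩ (p x)}
                (trans (cong z⟨ d ⟩ (px≡fx (proj₂ (pat x x≢τ′)))) (moved f d fτ f≢i)))
              (proj₂ (E-solve (z ∘ f) τ′≢τ)))
              where
              d = proj₁ (E-solve (z ∘ f) τ′≢τ)
              px≡fx : ∀ {m x} → typ m ≡ just x → m ≡ f x
              px≡fx tm with located tm
              ... | inj₁ m≡fx = m≡fx
              ... | inj₂ refl = contradiction (trans (sym tj) tm) λ()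

            module Double {σ : Fin k} (tj : typ j ≡ just σ) (σ≢τ : σ ≢ τ) (σ≢τ′ : σ ≢ τ′) where

              elsewhere : ∀ {m x} → typ m ≡ just x → x ≢ σ → m ≡ f x
              elsewhere tm x≢σ = [ id , (λ m≡j → contradiction (type-unique m≡j tm tj) x≢σ) ]′ (located tm)

              -- The choice of d makes the equation through s hold, where s is
              -- one of the two pebbles of type σ.
              module Choose (s : Fin k) (s≢i : s ≢ i) where

                q : Fin k → Fin k
                q = f [ σ ↦ s ]

                qτ : q τ ≡ i
                qτ = trans (↦-off f (σ≢τ ∘ sym)) fτ

                q≢i : ∀ {x} → x ≢ τ → q x ≢ i
                q≢i {x} x≢τ with x Fin.≟ σ
                ... | yes refl = s≢i
                ... | no  _    = f≢i x≢τ

                d : ℤ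
                d = proj₁ (E-solve (z ∘ q) τ′≢τ)

                solves : ∀ p → Pattern (λ _ → ⊤) τ′ p → Null (z (p σ) ℤ.- z s) → Null (E τ′ (z⟨ d ⟩ ∘ p))
                solves p pat null = E-resp τ′ diff (proj₂ (E-solve (z ∘ q) τ′≢τ))
                  where
                  diff : ∀ x → x ≢ τ′ → Null (z⟨ d ⟩ (p x) ℤ.- ((z ∘ q) [ τ ↦ d ]) x)
                  diff x x≢τ′ with x Fin.≟ σ
                  ... | no x≢σ = null-≡ {z⟨ d ⟩ (p x)} (trans
                          (cong z⟨ d ⟩ (trans (elsewhere (proj₂ (pat x x≢τ′)) x≢σ) (sym (↦-off f x≢σ))))
                          (moved q d qτ {x} q≢i))
                  ... | yes refl = subst₂ (λ a b → Null (a ℤ.- b))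
                          (sym (↦-off z (avoid (proj₂ (pat σ σ≢τ′)) σ≢τ)))
                          (sym (trans (↦-off (z ∘ q) {τ} {σ} {d} σ≢τ) (cong z (↦-at f {σ} refl)))) null

                response : (∀ {m} → typ m ≡ just σ → Null (z m ℤ.- z s) ⊎ (∀ c → X ≤ cost (lev m) c)) → Response X δ i z
                response close = line-response d λ p pat → case close (proj₂ (pat σ σ≢τ′)) of λ where
                  (inj₁ null) → inj₁ (solves p pat null)
                  (inj₂ X≤)   → inj₂ (σ , τ , σ≢τ , σ≢τ′ , τ′≢τ ∘ sym , X≤ (lev (p τ)))

              -- If the two pebbles of type `σ` moved alike, one `d` serves both. Otherwise their
              -- `hop` is at least `X`, so one of them is high enough to pay for every pattern
              -- through it, and `d` is chosen for the other.
              response : Response X δ i z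
              response with flat fτ′≢i (f≢i σ≢τ) tj (tf σ σ≢τ′)
              ... | inj₁ null = Choose.response (f σ) (f≢i σ≢τ) λ tm → inj₁
                    ([ (λ m≡fσ → null-≡ (cong z m≡fσ)) , (λ where refl → null) ]′ (located tm))
              ... | inj₂ X≤ with hop≤⇒cost≤ (≤-trans (s≤s z≤n) 2≤X) X≤
              ...   | inj₁ dear = Choose.response (f σ) (f≢i σ≢τ) λ tm →
                      [ (λ m≡fσ → inj₁ (null-≡ (cong z m≡fσ))) , (λ where refl → inj₂ dear) ]′ (located tm)
              ...   | inj₂ dear = Choose.response j fτ′≢i λ tm →
                      [ (λ where refl → inj₂ dear) , (λ m≡j → inj₁ (null-≡ (cong z m≡j))) ]′ (located tm)

        -- Exactly one pebble, `j`, is left over. If it shows `τ′`, each type is shown once and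
        -- `reply` applies. Otherwise only patterns omitting `τ′` exist, and `j` is untyped, a twin
        -- of `i` or a twin of another pebble.
        response : ∀ t → typ j ≡ t → Response X δ i z
        response nothing tj = Defective.Other.response-untyped
          (λ tj′ → contradiction (trans (sym tj) tj′) λ()) (λ tj′ → contradiction (trans (sym tj) tj′) λ()) tj
        response (just σ) tj with σ Fin.≟ τ′ | σ Fin.≟ τ
        ... | yes refl | _        = Rainbow.response tj
        ... | no σ≢τ′  | yes refl = Defective.Twin.response (σ≢τ′ ∘ type-unique refl tj) tj
        ... | no σ≢τ′  | no σ≢τ   = Defective.Other.Double.response
          (σ≢τ′ ∘ type-unique refl tj) (σ≢τ ∘ type-unique refl tj) tj σ≢τ σ≢τ′

      -- Sending both `τ` and `τ′` to `i` misses some pebble; giving that pebble to `τ′` turns the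
      -- assignment into a bijection.
      respond-covered : Covered → Response X δ i z
      respond-covered (τ′ , τ′≢τ , cover) = Cover.response f τ′≢τ hits fτ tf fτ′≢i _ refl
        where
        g : Fin k → Fin k
        g ρ with ρ Fin.≟ τ | ρ Fin.≟ τ′
        ... | yes _  | _       = i
        ... | no _   | yes _   = i
        ... | no ρ≢τ | no ρ≢τ′ = proj₁ (cover ρ ρ≢τ ρ≢τ′)

        gτ : g τ ≡ i
        gτ with τ Fin.≟ τ | τ Fin.≟ τ′
        ... | yes _  | _ = refl
        ... | no τ≢τ | _ = contradiction refl τ≢τ

        gτ′ : g τ′ ≡ i
        gτ′ with τ′ Fin.≟ τ | τ′ Fin.≟ τ′
        ... | yes _ | _        = refl
        ... | no _  | yes _    = refl
        ... | no _  | no τ′≢τ′ = contradiction refl τ′≢τ′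

        tg : ∀ ρ → ρ ≢ τ′ → typ (g ρ) ≡ just ρ
        tg ρ ρ≢τ′ with ρ Fin.≟ τ | ρ Fin.≟ τ′
        ... | yes refl | _       = ti
        ... | no _     | yes ρ≡τ′ = contradiction ρ≡τ′ ρ≢τ′
        ... | no ρ≢τ   | no ρ≢τ″ = proj₂ (proj₂ (cover ρ ρ≢τ ρ≢τ″))

        miss : ∃[ m ] (∀ ρ → g ρ ≢ m)
        miss = missed g τ′≢τ (trans gτ′ (sym gτ))

        f : Fin k → Fin k
        f = g [ τ′ ↦ proj₁ miss ]

        fτ : f τ ≡ i
        fτ = trans (↦-off g (τ′≢τ ∘ sym)) gτ

        tf : ∀ ρ → ρ ≢ τ′ → typ (f ρ) ≡ just ρ
        tf ρ ρ≢τ′ = trans (cong typ (↦-off g ρ≢τ′)) (tg ρ ρ≢τ′)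

        f≢miss : ∀ {ρ} → ρ ≢ τ′ → f ρ ≢ f τ′
        f≢miss {ρ} ρ≢τ′ eq = proj₂ miss ρ (trans (sym (↦-off g ρ≢τ′)) (trans eq (↦-at g {τ′} refl)))

        fτ′≢i : f τ′ ≢ i
        fτ′≢i eq = f≢miss (τ′≢τ ∘ sym) (trans fτ (sym eq))

        f-injective : ∀ {x y} → f x ≡ f y → x ≡ y
        f-injective {x} {y} eq = by (x Fin.≟ τ′) (y Fin.≟ τ′)
          where
          by : Dec (x ≡ τ′) → Dec (y ≡ τ′) → x ≡ y
          by (yes x≡τ′) (yes y≡τ′) = trans x≡τ′ (sym y≡τ′)
          by (yes refl) (no y≢τ′)  = contradiction (sym eq) (f≢miss y≢τ′)
          by (no x≢τ′)  (yes refl) = contradiction eq (f≢miss x≢τ′)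
          by (no x≢τ′)  (no y≢τ′)  = type-unique eq (tf x x≢τ′) (tf y y≢τ′)

        hits : ∀ m → ∃[ ρ ] f ρ ≡ m
        hits = injective⇒surjective f f-injective

      respond-typed : Response X δ i z
      respond-typed with covered?
      ... | yes covered  = respond-covered covered
      ... | no uncovered = respond-uncovered uncovered

  respond : ∀ {X} δ i z → 2 ≤ X → X ≤ 2 ^ D → Facts (_≢ i) X z → Response X δ i z
  respond δ i z 2≤X X≤2^D known = by (typ i) refl
    where
    by : ∀ t → typ i ≡ t → Response _ δ i z
    by nothing  ti = Respond.respond-untyped 2≤X X≤2^D known ti
    by (just τ) ti = Respond.Typed.respond-typed 2≤X X≤2^D known ti

-- Invariance of the facts under congruence and sign of the shifts.

module Matching (k : ℕ) (3≤k : 3 ≤ k) (D : ℕ) where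

  open Levels k 3≤k D
  open Pebbles k 3≤k D

  module _ {typ typ′ : Fin k → Maybe (Fin k)} {lev lev′ : Fin k → ℕ} where

    Facts-resp : ∀ (on : Fin k → Set) {X} z z′ → (∀ {m} → on m → typ′ m ≡ typ m) → (∀ {m} → on m → lev′ m ≡ lev m) →
      (∀ m {ρ} → on m → typ m ≡ just ρ → Null (z′ m ℤ.- z m)) → Facts typ lev on X z → Facts typ′ lev′ on X z′
    Facts-resp on {X} z z′ typ≡ lev≡ z≈ F = record { flat = flat′ ; line = line′ }
      where
      open Facts _ _ F
      flat′ : ∀ {j j′ σ} → on j → on j′ → typ′ j ≡ just σ → typ′ j′ ≡ just σ →
              Null (z′ j ℤ.- z′ j′) ⊎ X ≤ hop (lev′ j) (lev′ j′)
      flat′ {j} {j′} oj oj′ tj′ tj″ with trans (sym (typ≡ oj)) tj′ | trans (sym (typ≡ oj′)) tj″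
      ... | tj | t with flat oj oj′ tj t
      ...   | inj₂ X≤ rewrite lev≡ oj | lev≡ oj′ = inj₂ X≤
      ...   | inj₁ null = inj₁ (subst Null (lemma (z′ j) (z j) (z′ j′) (z j′))
                (null-+ (null-+ (z≈ j oj tj) null) (null-neg (z≈ j′ oj′ t))))
        where
        lemma : ∀ a b c d → ((a ℤ.- b) ℤ.+ (b ℤ.- d)) ℤ.+ (ℤ.- (c ℤ.- d)) ≡ a ℤ.- c
        lemma = solve-∀
      line′ : ∀ τ p → (∀ ρ → ρ ≢ τ → on (p ρ) × typ′ (p ρ) ≡ just ρ) → Ok X (lev′ ∘ p) τ (z′ ∘ p)
      line′ τ p pat = Ok-resp ≤-refl (λ ρ ρ≢τ → lev≡ (proj₁ (pat ρ ρ≢τ)))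
        (λ ρ ρ≢τ → z≈ (p ρ) (proj₁ (pat ρ ρ≢τ)) (proj₂ (old ρ ρ≢τ))) (line τ p old)
        where
        old : ∀ ρ → ρ ≢ τ → on (p ρ) × typ (p ρ) ≡ just ρ
        old ρ ρ≢τ = let o , t = pat ρ ρ≢τ in o , trans (sym (typ≡ o)) t

    Lawful-resp : ∀ {δ} z z′ → (∀ m → typ′ m ≡ typ m) → (∀ m → lev′ m ≡ lev m) →
      (∀ m {ρ} → typ m ≡ just ρ → Null (z′ m ℤ.- z m)) → Lawful typ lev δ z → Lawful typ′ lev′ δ z′
    Lawful-resp z z′ typ≡ lev≡ z≈ lawful p full = Legal-resp (λ ρ → lev≡ (p ρ)) (λ ρ → z≈ (p ρ) (full′ ρ)) (lawful p full′)
      where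
      full′ : ∀ ρ → typ (p ρ) ≡ just ρ
      full′ ρ = trans (sym (typ≡ (p ρ))) (full ρ)

  module _ {typ : Fin k → Maybe (Fin k)} {lev : Fin k → ℕ} where

    Facts-neg : ∀ (on : Fin k → Set) {X z} → Facts typ lev on X z → Facts typ lev on X (λ m → ℤ.- z m)
    Facts-neg on {z = z} F = record
      { flat = λ {j} {j′} oj oj′ tj tj′ →
          [ (λ null → inj₁ (subst Null (lemma (z j) (z j′)) (null-neg null))) , inj₂ ]′ (flat oj oj′ tj tj′)
      ; line = λ τ p pat → [ inj₁ ∘ E-neg τ , inj₂ ]′ (line τ p pat) }
      where
      open Facts _ _ F
      lemma : ∀ a b → ℤ.- (a ℤ.- b) ≡ (ℤ.- a) ℤ.- (ℤ.- b)
      lemma = solve-∀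

-- The two structures and the positions of the game on them.

module Game (k : ℕ) (3≤k : 3 ≤ k) (D r : ℕ) where

  open Levels k 3≤k D
  open Pebbles k 3≤k D
  open Matching k 3≤k D

  -- The `r` untyped elements are padding, so that every large size is reached exactly.
  Elem : Set
  Elem = (Fin k × Fin (suc D) × Fin modulus) ⊎ Fin r

  typ : Elem → Maybe (Fin k)
  typ (inj₁ (τ , _ , _)) = just τ
  typ (inj₂ _)           = nothing

  -- The level of an untyped element is only used to tell such elements apart.
  lev : Elem → ℕ
  lev (inj₁ (_ , l , _)) = toℕ l
  lev (inj₂ c)           = toℕ c

  val : Elem → ℤ
  val (inj₁ (_ , _ , v)) = + toℕ v
  val (inj₂ _)           = 0ℤ

  -- A tuple that does not show the types in order is related vacuously.
  Equation : ℤ → (Fin k → Elem) → Set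
  Equation κ x = (∀ ρ → typ (x ρ) ≡ just ρ) → Legal κ (lev ∘ x) (val ∘ x)

  Equation? : ∀ κ x → Dec (Equation κ x)
  Equation? κ x = Fin.all? (λ ρ → Maybe.≡-dec Fin._≟_ (typ (x ρ)) (just ρ)) →-dec Legal? κ (lev ∘ x) (val ∘ x)

  At : Fin k × Fin (suc D) → Elem → Set
  At (τ , l) e = typ e ≡ just τ × lev e ≡ toℕ l

  At? : ∀ c e → Dec (At c e)
  At? (τ , l) e = Maybe.≡-dec Fin._≟_ (typ e) (just τ) ×-dec (lev e ≟ toℕ l)

  sig : Signature
  sig = record { symbols = suc (k * suc D) ; arity = λ { zero → k ; (suc _) → 1 } }

  struct : ℤ → Structure sig
  struct κ = record { Carrier = Elem ; rel = λ where
    zero    x       → ⌊ Equation? κ (lookup x) ⌋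
    (suc c) (e ∷ _) → ⌊ At? (Fin.remQuot (suc D) c) e ⌋ }

  -- Values are residues below the modulus, so congruent ones coincide.
  Elem-≡ : ∀ {e e′} → typ e ≡ typ e′ → lev e ≡ lev e′ → (∀ {ρ} → typ e ≡ just ρ → Null (val e ℤ.- val e′)) → e ≡ e′
  Elem-≡ {inj₂ c} {inj₂ c′} _ lev≡ _ = cong inj₂ (Fin.toℕ-injective lev≡)
  Elem-≡ {inj₁ (τ , l , v)} {inj₁ (.τ , l′ , v′)} refl lev≡ null with refl ← Fin.toℕ-injective lev≡ =
    cong (λ v → inj₁ (τ , l , v)) (Fin.toℕ-injective (ℤ.+-injective (ℤ.i-j≡0⇒i≡j _ _ (ℤ.∣i∣≡0⇒i≡0
      (small (Signed.∣⇒∣ᵤ (null refl)) bound)))))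
    where
    small : ∀ {m} → modulus ℕ.∣ m → m < modulus → m ≡ 0
    small {zero}  _ _ = refl
    small {suc m} d m<N = contradiction (ℕ.∣⇒≤ d) (<⇒≱ m<N)
    bound : ∣ + toℕ v ℤ.- + toℕ v′ ∣ < modulus
    bound = ≤-<-trans (≤-reflexive (cong ∣_∣ (ℤ.[+m]-[+n]≡m⊖n (toℕ v) (toℕ v′))))
      (≤-<-trans (ℤ.∣m⊝n∣≤m⊔n (toℕ v) (toℕ v′)) (⊔-lub (Fin.toℕ<n v) (Fin.toℕ<n v′)))

  move : Elem → ℤ → Elem
  move (inj₁ (τ , l , v)) d = inj₁ (τ , l , Fin.fromℕ< (ℤ.n%ℕd<d (+ toℕ v ℤ.+ d) modulus))
  move (inj₂ c)           d = inj₂ c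

  typ-move : ∀ e d → typ (move e d) ≡ typ e
  typ-move (inj₁ _) d = refl
  typ-move (inj₂ _) d = refl

  lev-move : ∀ e d → lev (move e d) ≡ lev e
  lev-move (inj₁ _) d = refl
  lev-move (inj₂ _) d = refl

  val-move : ∀ e d {ρ} → typ e ≡ just ρ → Null ((val (move e d) ℤ.- val e) ℤ.- d)
  val-move (inj₁ (τ , l , v)) d _ rewrite Fin.toℕ-fromℕ< (ℤ.n%ℕd<d (+ toℕ v ℤ.+ d) modulus) =
    divides (ℤ.- q) (trans (cong (λ a → (+ m ℤ.- + toℕ v) ℤ.- a) d≡) (lemma (+ m) (+ toℕ v) q (+ modulus)))
    where
    m = (+ toℕ v ℤ.+ d) ℤ.%ℕ modulus
    q = (+ toℕ v ℤ.+ d) ℤ./ℕ modulus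
    d≡ : d ≡ (+ m ℤ.+ q ℤ.* + modulus) ℤ.- + toℕ v
    d≡ = trans (lemma₀ d (+ toℕ v)) (cong (ℤ._- + toℕ v) (ℤ.a≡a%ℕn+[a/ℕn]*n (+ toℕ v ℤ.+ d) modulus))
      where
      lemma₀ : ∀ d v → d ≡ (v ℤ.+ d) ℤ.- v
      lemma₀ = solve-∀
    lemma : ∀ m v q N → (m ℤ.- v) ℤ.- ((m ℤ.+ q ℤ.* N) ℤ.- v) ≡ (ℤ.- q) ℤ.* N
    lemma = solve-∀

  Pebbling : Set
  Pebbling = Vec Elem k

  shift : Pebbling → Pebbling → Fin k → ℤ
  shift s t m = val (lookup t m) ℤ.- val (lookup s m)

  record Similar (s t : Pebbling) : Set where
    field
      typ≡ : ∀ m → typ (lookup t m) ≡ typ (lookup s m)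
      lev≡ : ∀ m → lev (lookup t m) ≡ lev (lookup s m)

  record Coupled (on : Fin k → Set) (X : ℕ) (s t : Pebbling) : Set where
    field
      similar : Similar s t
      facts   : Facts (typ ∘ lookup s) (lev ∘ lookup s) on X (shift s t)
    open Similar similar public

  record Close (X : ℕ) (κ κ′ : ℤ) (s t : Pebbling) : Set where
    field
      coupled : Coupled (λ _ → ⊤) X s t
      lawful  : Lawful (typ ∘ lookup s) (lev ∘ lookup s) (κ′ ℤ.- κ) (shift s t)
    open Coupled coupled public

  -- Both prongs answer the same move in `s`; a formula has to be preserved along only one of them.
  record Fork (X : ℕ) (κ κ′ : ℤ) (s t₁ t₂ : Pebbling) : Set where
    field
      X₁ X₂  : ℕ
      share  : X ≤ X₁ + X₂
      close₁ : Close X₁ κ κ′ s t₁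
      close₂ : Close X₂ κ κ′ s t₂
      either : ∀ m → Coupled (_≢ m) X s t₁ ⊎ Coupled (_≢ m) X s t₂

  private
    minus : ∀ a b → ℤ.- (a ℤ.- b) ≡ b ℤ.- a
    minus = solve-∀

  Coupled-sym : ∀ (on : Fin k → Set) {X s t} → Coupled on X s t → Coupled on X t s
  Coupled-sym on {X} {s} {t} C = record
    { similar = record { typ≡ = sym ∘ typ≡ ; lev≡ = sym ∘ lev≡ }
    ; facts = Facts-resp on (λ m → ℤ.- shift s t m) (shift t s) (λ {m} _ → typ≡ m) (λ {m} _ → lev≡ m)
        (λ m _ _ → null-≡ {shift t s m} (sym (minus (val (lookup t m)) (val (lookup s m))))) (Facts-neg on {z = shift s t} facts) }
    where open Coupled C

  Close-sym : ∀ {X κ κ′ s t} → Close X κ κ′ s t → Close X κ′ κ t s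
  Close-sym {X} {κ} {κ′} {s} {t} C = record
    { coupled = Coupled-sym (λ _ → ⊤) coupled
    ; lawful = subst (λ δ → Lawful (typ ∘ lookup t) (lev ∘ lookup t) δ (shift t s)) (minus κ′ κ)
        (Lawful-resp (λ m → ℤ.- shift s t m) (shift t s) typ≡ lev≡ (λ m _ → null-≡ {shift t s m} (sym (minus (val (lookup t m)) (val (lookup s m)))))
          (λ p full → Legal-neg (lawful p full))) }
    where open Close C

  Coupled-weaken : ∀ {on on′ : Fin k → Set} {X X′ s t} → (∀ {m} → on′ m → on m) → X′ ≤ X → Coupled on X s t → Coupled on′ X′ s t
  Coupled-weaken on′⇒on X′≤X C = record
    { similar = similar ; facts = Facts-weaken _ _ on′⇒on X′≤X facts }
    where open Coupled C

  Close-weaken : ∀ {X X′ κ κ′ s t} → X′ ≤ X → Close X κ κ′ s t → Close X′ κ κ′ s t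
  Close-weaken X′≤X C = record { coupled = Coupled-weaken {λ _ → ⊤} {λ _ → ⊤} (λ o → o) X′≤X coupled ; lawful = lawful }
    where open Close C

  challenge : ∀ {X s t} κ κ′ i a → 2 ≤ X → X ≤ 2 ^ D → Coupled (_≢ i) X s t →
              ∃[ b₁ ] ∃[ b₂ ] Fork X κ κ′ (s [ i ]≔ a) (t [ i ]≔ b₁) (t [ i ]≔ b₂)
  challenge {X} {s} {t} κ κ′ i a 2≤X X≤2^D C = move a d₁ , move a d₂ , record
    { X₁ = X₁ ; X₂ = X₂ ; share = share
    ; close₁ = close (proj₁ safe₁) (proj₂ safe₁)
    ; close₂ = close (proj₁ safe₂) (proj₂ safe₂)
    ; either = λ m → [ inj₁ ∘ coupled (_≢ m) , inj₂ ∘ coupled (_≢ m) ]′ (either m) }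
    where
    open Coupled C
    s′ : Pebbling
    s′ = s [ i ]≔ a
    t′ : ℤ → Pebbling
    t′ d = t [ i ]≔ move a d
    old : ∀ (u : Pebbling) b {m} → m ≢ i → lookup (u [ i ]≔ b) m ≡ lookup u m
    old u b m≢i = Vec.lookup∘update′ m≢i u b
    known : Facts (typ ∘ lookup s′) (lev ∘ lookup s′) (_≢ i) X (shift s t)
    known = Facts-resp (_≢ i) (shift s t) (shift s t) (λ m≢i → cong typ (old s a m≢i)) (λ m≢i → cong lev (old s a m≢i))
      (λ m _ _ → null-≡ {shift s t m} refl) facts
    open Response _ _ (respond _ _ (κ′ ℤ.- κ) i (shift s t) 2≤X X≤2^D known)
    similar′ : ∀ d → Similar s′ (t′ d)
    similar′ d = record { typ≡ = λ m → proj₁ (go m) ; lev≡ = λ m → proj₂ (go m) }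
      where
      go : ∀ m → typ (lookup (t′ d) m) ≡ typ (lookup s′ m) × lev (lookup (t′ d) m) ≡ lev (lookup s′ m)
      go m with m Fin.≟ i
      ... | yes refl rewrite Vec.lookup∘update i s a | Vec.lookup∘update i t (move a d) = typ-move a d , lev-move a d
      ... | no m≢i rewrite old s a m≢i | old t (move a d) m≢i = typ≡ m , lev≡ m
    shift′ : ∀ d m {ρ} → typ (lookup s′ m) ≡ just ρ → Null (shift s′ (t′ d) m ℤ.- (shift s t [ i ↦ d ]) m)
    shift′ d m tm with m Fin.≟ i
    ... | yes refl rewrite Vec.lookup∘update i s a | Vec.lookup∘update i t (move a d) = val-move a d tm
    ... | no m≢i rewrite old s a m≢i | old t (move a d) m≢i = null-≡ {shift s t m} refl
    coupled : ∀ (on : Fin k → Set) {X d} → Facts (typ ∘ lookup s′) (lev ∘ lookup s′) on X (shift s t [ i ↦ d ]) → Coupled on X s′ (t′ d)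
    coupled on {d = d} F = record { similar = similar′ d
      ; facts = Facts-resp on (shift s t [ i ↦ d ]) (shift s′ (t′ d)) (λ _ → refl) (λ _ → refl) (λ m _ → shift′ d m) F }
    close : ∀ {X d} → Facts (typ ∘ lookup s′) (lev ∘ lookup s′) (λ _ → ⊤) X (shift s t [ i ↦ d ]) → Lawful (typ ∘ lookup s′) (lev ∘ lookup s′) (κ′ ℤ.- κ) (shift s t [ i ↦ d ]) →
            Close X κ κ′ s′ (t′ d)
    close {d = d} F lawful = record { coupled = coupled (λ _ → ⊤) F
      ; lawful = Lawful-resp {lev = lev ∘ lookup s′} (shift s t [ i ↦ d ]) (shift s′ (t′ d)) (λ _ → refl) (λ _ → refl) (shift′ d) lawful }

  infix 4 _∣_⊩_
  _∣_⊩_ : ℤ → Pebbling → Formula sig k → Set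
  κ ∣ s ⊩ φ = struct κ , s ⊨ φ

  atom-transfer : ∀ R ys {κ κ′ s t} → Close 1 κ κ′ s t → κ ∣ s ⊩ atom R ys → κ′ ∣ t ⊩ atom R ys
  atom-transfer (suc c) (y ∷ []) {s = s} {t} C holds = fromWitness {a? = At? at (lookup t y)}
    (let typ-s , lev-s = toWitness {a? = At? at (lookup s y)} holds
     in trans (typ≡ y) typ-s , trans (lev≡ y) lev-s)
    where
    open Close C
    at = Fin.remQuot (suc D) c
  atom-transfer zero ys {κ} {κ′} {s} {t} C holds = fromWitness {a? = Equation? κ′ (lookup (Vec.map (lookup t) ys))} 
    λ full →
      let full-t ρ = trans (cong typ (sym (at t ρ))) (full ρ)
          full-s ρ = trans (sym (typ≡ (lookup ys ρ))) (full-t ρ)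
          legal = toWitness {a? = Equation? κ (lookup (Vec.map (lookup s) ys))} holds
                    (λ ρ → trans (cong typ (at s ρ)) (full-s ρ))
      in Legal-resp
           (λ ρ → trans (cong lev (at t ρ)) (trans (lev≡ (lookup ys ρ)) (cong lev (sym (at s ρ)))))
           (λ ρ → null-≡ (trans (cong val (at t ρ)) (trans (lemma _ (val (lookup s (lookup ys ρ))))
                    (cong (λ e → val e ℤ.+ shift s t (lookup ys ρ)) (sym (at s ρ))))))
           -- Laws are additive: the tuple in `t` is the tuple in `s` plus the shift, and the
           -- constants `κ` and `κ′ - κ` add up to `κ′`.
           (subst (λ δ → Legal δ _ _) (lemma′ κ κ′)
             (Legal-+ legal (Legal-resp (λ ρ → cong lev (at s ρ)) (λ ρ → null-≡ {shift s t (lookup ys ρ)} refl)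
               (lawful (lookup ys) full-s))))
    where
    open Close C
    at : ∀ (u : Pebbling) ρ → lookup (Vec.map (lookup u) ys) ρ ≡ lookup u (lookup ys ρ)
    at u ρ = Vec.lookup-map ρ (lookup u) ys
    lemma : ∀ a b → a ≡ b ℤ.+ (a ℤ.- b)
    lemma = solve-∀
    lemma′ : ∀ a b → a ℤ.+ (b ℤ.- a) ≡ b
    lemma′ = solve-∀

  -- Pebbles on one element have `hop` 0, which is below 1, so `flat` makes their shifts congruent.
  ≐-transfer : ∀ y z {κ κ′ s t} → Close 1 κ κ′ s t → lookup s y ≡ lookup s z → lookup t y ≡ lookup t z
  ≐-transfer y z {s = s} {t} C sy≡sz = Elem-≡
    (trans (typ≡ y) (trans (cong typ sy≡sz) (sym (typ≡ z))))
    (trans (lev≡ y) (trans (cong lev sy≡sz) (sym (lev≡ z)))) null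
    where
    open Close C
    open Facts _ _ facts
    lemma : ∀ a b c → (a ℤ.- c) ℤ.- (b ℤ.- c) ≡ a ℤ.- b
    lemma = solve-∀
    null : ∀ {ρ} → typ (lookup t y) ≡ just ρ → Null (val (lookup t y) ℤ.- val (lookup t z))
    null ty with flat tt tt (trans (sym (typ≡ y)) ty) (trans (cong typ (sym sy≡sz)) (trans (sym (typ≡ y)) ty))
    ... | inj₁ null = subst Null (trans
          (cong (λ e → shift s t y ℤ.- (val (lookup t z) ℤ.- val e)) (sym sy≡sz))
          (lemma (val (lookup t y)) (val (lookup t z)) (val (lookup s y)))) null
    ... | inj₂ 1≤hop = contradiction (≤-trans 1≤hop (≤-reflexive (hop-refl (cong lev sy≡sz)))) λ()

  -- A formula of p quantifiers tells nothing apart at a prong of cost above p, so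
  -- two formulas that separate s from different prongs cost at least X₁ + X₂.
  prongs : ∀ {A₁ A₂ B₁ B₂ : Set} {X X₁ X₂ p q} → X ≤ X₁ + X₂ → p + q < X → A₁ ⊎ A₂ → B₁ ⊎ B₂ →
           (p < X₁ → A₁) → (p < X₂ → A₂) → (q < X₁ → B₁) → (q < X₂ → B₂) → (A₁ × B₁) ⊎ (A₂ × B₂)
  prongs _ _ (inj₁ a) (inj₁ b) _ _ _ _ = inj₁ (a , b)
  prongs _ _ (inj₂ a) (inj₂ b) _ _ _ _ = inj₂ (a , b)
  prongs {X₁ = X₁} {X₂} {p} {q} share small (inj₁ a) (inj₂ b) _ a₂ b₁ _ with q <? X₁ | p <? X₂
  ... | yes q<X₁ | _ = inj₁ (a , b₁ q<X₁)
  ... | no _ | yes p<X₂ = inj₂ (a₂ p<X₂ , b)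
  ... | no q≮X₁ | no p≮X₂ = contradiction
        (≤-trans share (≤-trans (+-mono-≤ (≮⇒≥ q≮X₁) (≮⇒≥ p≮X₂)) (≤-reflexive (+-comm q p)))) (<⇒≱ small)
  prongs {X₁ = X₁} {X₂} {p} {q} share small (inj₂ a) (inj₁ b) a₁ _ _ b₂ with q <? X₂ | p <? X₁
  ... | yes q<X₂ | _ = inj₂ (a , b₂ q<X₂)
  ... | no _ | yes p<X₁ = inj₁ (a₁ p<X₁ , b)
  ... | no q≮X₂ | no p≮X₁ = contradiction
        (≤-trans share (+-mono-≤ (≮⇒≥ p≮X₁) (≮⇒≥ q≮X₂))) (<⇒≱ small)

  -- The shares have a positive sum, so one of them is at least 1, which is enough for an atomic
  -- formula.
  sharp : ∀ {X κ κ′ s t₁ t₂} → 0 < X → Fork X κ κ′ s t₁ t₂ → Close 1 κ κ′ s t₁ ⊎ Close 1 κ κ′ s t₂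
  sharp 0<X F with Fork.X₁ F in eq
  ... | suc _ = inj₁ (Close-weaken (≤-trans (s≤s z≤n) (≤-reflexive (sym eq))) (Fork.close₁ F))
  ... | zero  = inj₂ (Close-weaken (≤-trans 0<X (≤-trans (Fork.share F) (≤-reflexive (cong (_+ Fork.X₂ F) eq)))) (Fork.close₂ F))

  Iff : (κ κ′ : ℤ) (s t : Pebbling) (φ : Formula sig k) → Set
  Iff κ κ′ s t φ = (κ ∣ s ⊩ φ → κ′ ∣ t ⊩ φ) × (κ′ ∣ t ⊩ φ → κ ∣ s ⊩ φ)

  transfer : ∀ φ {X κ κ′ s t} → quantifiers φ < X → quantifiers φ < 2 ^ D → Close X κ κ′ s t →
             κ ∣ s ⊩ φ → κ′ ∣ t ⊩ φ
  transfer-⇔ : ∀ φ {X κ κ′ s t} → quantifiers φ < X → quantifiers φ < 2 ^ D → Close X κ κ′ s t → Iff κ κ′ s t φ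
  -- The chosen prong serves both directions, which lets negation pass. Two conjuncts or disjuncts
  -- may prefer different prongs, and `prongs` reconciles them. A quantifier over `i` forgets pebble
  -- `i`, so by `either` one prong still offers the full `X`.
  fork : ∀ φ {X κ κ′ s t₁ t₂} → quantifiers φ < X → quantifiers φ < 2 ^ D → Fork X κ κ′ s t₁ t₂ →
         Iff κ κ′ s t₁ φ ⊎ Iff κ κ′ s t₂ φ
  transfer-∃ : ∀ i φ {X κ κ′ s t} → suc (quantifiers φ) < X → suc (quantifiers φ) < 2 ^ D →
               Coupled (_≢ i) X s t → κ ∣ s ⊩ ∃′ i φ → κ′ ∣ t ⊩ ∃′ i φ
  transfer-∀ : ∀ i φ {X κ κ′ s t} → suc (quantifiers φ) < X → suc (quantifiers φ) < 2 ^ D →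
               Coupled (_≢ i) X s t → κ ∣ s ⊩ ∀′ i φ → κ′ ∣ t ⊩ ∀′ i φ

  challenge-fork : ∀ i φ {X κ κ′ s t} → suc (quantifiers φ) < X → suc (quantifiers φ) < 2 ^ D →
    Coupled (_≢ i) X s t → ∀ a → ∃[ b ] Iff κ κ′ (s [ i ]≔ a) (t [ i ]≔ b) φ

  challenge-fork i φ {κ = κ} {κ′} q<X q<2^D C a =
    -- The cost is lowered to two more than `quantifiers φ`: it stays above that number, is at least
    -- 2 and does not exceed `2 ^ D`.
    let b₁ , b₂ , F = challenge κ κ′ i a (s≤s (s≤s z≤n)) q<2^D (Coupled-weaken {_≢ i} {_≢ i} (λ o → o) q<X C)
    in [ (λ iff → b₁ , iff) , (λ iff → b₂ , iff) ]′ (fork φ (s≤s (n≤1+n _)) (<-trans (n<1+n _) q<2^D) F)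

  transfer-⇔ φ q<X q<2^D C = transfer φ q<X q<2^D C , transfer φ q<X q<2^D (Close-sym C)

  transfer-∃ i φ q<X q<2^D C (a , holds) =
    let b , iff = challenge-fork i φ q<X q<2^D C a in b , proj₁ iff holds

  transfer-∀ i φ q<X q<2^D C holds b =
    let a , iff = challenge-fork i φ q<X q<2^D (Coupled-sym (_≢ i) C) b in proj₂ iff (holds a)

  transfer (atom R ys) q<X _ C = atom-transfer R ys (Close-weaken q<X C)
  transfer (y ≐ z) q<X _ C = ≐-transfer y z (Close-weaken q<X C)
  transfer (¬′ φ) q<X q<2^D C ¬φ holds = ¬φ (transfer φ q<X q<2^D (Close-sym C) holds)
  transfer (φ ∧′ ψ) q<X q<2^D C (a , b) =
    transfer φ (m+n≤o⇒m≤o _ q<X) (m+n≤o⇒m≤o _ q<2^D) C a ,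
    transfer ψ (≤-<-trans (m≤n+m _ _) q<X) (≤-<-trans (m≤n+m _ _) q<2^D) C b
  transfer (φ ∨′ ψ) q<X q<2^D C (inj₁ a) = inj₁ (transfer φ (m+n≤o⇒m≤o _ q<X) (m+n≤o⇒m≤o _ q<2^D) C a)
  transfer (φ ∨′ ψ) q<X q<2^D C (inj₂ b) = inj₂
    (transfer ψ (≤-<-trans (m≤n+m _ _) q<X) (≤-<-trans (m≤n+m _ _) q<2^D) C b)
  transfer (∃′ i φ) q<X q<2^D C = transfer-∃ i φ q<X q<2^D (Coupled-weaken {on′ = _≢ i} (λ _ → tt) ≤-refl (Close.coupled C))
  transfer (∀′ i φ) q<X q<2^D C = transfer-∀ i φ q<X q<2^D (Coupled-weaken {on′ = _≢ i} (λ _ → tt) ≤-refl (Close.coupled C))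

  fork (atom R ys) q<X q<2^D F = [ inj₁ ∘ iff , inj₂ ∘ iff ]′ (sharp q<X F)
    where
    iff : ∀ {κ κ′ s t} → Close 1 κ κ′ s t → Iff κ κ′ s t (atom R ys)
    iff C = atom-transfer R ys C , atom-transfer R ys (Close-sym C)
  fork (y ≐ z) q<X q<2^D F = [ inj₁ ∘ iff , inj₂ ∘ iff ]′ (sharp q<X F)
    where
    iff : ∀ {κ κ′ s t} → Close 1 κ κ′ s t → Iff κ κ′ s t (y ≐ z)
    iff C = ≐-transfer y z C , ≐-transfer y z (Close-sym C)
  fork (¬′ φ) {s = s} q<X q<2^D F = [ inj₁ ∘ neg , inj₂ ∘ neg ]′ (fork φ q<X q<2^D F)
    where
    neg : ∀ {κ κ′ s t} → Iff κ κ′ s t φ → Iff κ κ′ s t (¬′ φ)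
    neg (to , from) = _∘ from , _∘ to
  fork (φ ∧′ ψ) q<X q<2^D F = [ inj₁ ∘ both , inj₂ ∘ both ]′
    (prongs share q<X (fork φ (m+n≤o⇒m≤o _ q<X) p F) (fork ψ (≤-<-trans (m≤n+m _ _) q<X) q F)
      (λ p<X → transfer-⇔ φ p<X p close₁) (λ p<X → transfer-⇔ φ p<X p close₂)
      (λ q<X → transfer-⇔ ψ q<X q close₁) (λ q<X → transfer-⇔ ψ q<X q close₂))
    where
    open Fork F
    p = m+n≤o⇒m≤o _ q<2^D
    q = ≤-<-trans (m≤n+m _ (quantifiers φ)) q<2^D
    both : ∀ {κ κ′ s t} → Iff κ κ′ s t φ × Iff κ κ′ s t ψ → Iff κ κ′ s t (φ ∧′ ψ)
    both ((f , f′) , (g , g′)) = (λ (a , b) → f a , g b) , (λ (a , b) → f′ a , g′ b)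
  fork (φ ∨′ ψ) q<X q<2^D F = [ inj₁ ∘ both , inj₂ ∘ both ]′
    (prongs share q<X (fork φ (m+n≤o⇒m≤o _ q<X) p F) (fork ψ (≤-<-trans (m≤n+m _ _) q<X) q F)
      (λ p<X → transfer-⇔ φ p<X p close₁) (λ p<X → transfer-⇔ φ p<X p close₂)
      (λ q<X → transfer-⇔ ψ q<X q close₁) (λ q<X → transfer-⇔ ψ q<X q close₂))
    where
    open Fork F
    p = m+n≤o⇒m≤o _ q<2^D
    q = ≤-<-trans (m≤n+m _ (quantifiers φ)) q<2^D
    both : ∀ {κ κ′ s t} → Iff κ κ′ s t φ × Iff κ κ′ s t ψ → Iff κ κ′ s t (φ ∨′ ψ)
    both ((f , f′) , (g , g′)) = [ inj₁ ∘ f , inj₂ ∘ g ]′ , [ inj₁ ∘ f′ , inj₂ ∘ g′ ]′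
  fork (∃′ i φ) q<X q<2^D F = [ inj₁ ∘ iff , inj₂ ∘ iff ]′ (Fork.either F i)
    where
    iff : ∀ {κ κ′ s t} → Coupled (_≢ i) _ s t → Iff κ κ′ s t (∃′ i φ)
    iff C = transfer-∃ i φ q<X q<2^D C , transfer-∃ i φ q<X q<2^D (Coupled-sym (_≢ i) C)
  fork (∀′ i φ) q<X q<2^D F = [ inj₁ ∘ iff , inj₂ ∘ iff ]′ (Fork.either F i)
    where
    iff : ∀ {κ κ′ s t} → Coupled (_≢ i) _ s t → Iff κ κ′ s t (∀′ i φ)
    iff C = transfer-∀ i φ q<X q<2^D C , transfer-∀ i φ q<X q<2^D (Coupled-sym (_≢ i) C)

-- Free variables, decidability of satisfaction and existential closure.

map-cong-∈ : ∀ {n} {A B : Set} {f g : A → B} (xs : Vec A n) →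
             (∀ x → x VecMembership.∈ xs → f x ≡ g x) → Vec.map f xs ≡ Vec.map g xs
map-cong-∈ []       eq = refl
map-cong-∈ (x ∷ xs) eq = cong₂ _∷_ (eq x (VecAny.here refl)) (map-cong-∈ xs (λ y → eq y ∘ VecAny.there))

module _ {σ : Signature} {k : ℕ} (𝒜 : Structure σ) where

  coincidence : ∀ (φ : Formula σ k) {s t} → (∀ x → x FreeIn φ → lookup s x ≡ lookup t x) →
                𝒜 , s ⊨ φ → 𝒜 , t ⊨ φ
  coincidence-[]≔ : ∀ (φ : Formula σ k) {i s t} → (∀ x → x ≢ i × x FreeIn φ → lookup s x ≡ lookup t x) →
                    ∀ a → 𝒜 , s [ i ]≔ a ⊨ φ → 𝒜 , t [ i ]≔ a ⊨ φ
  coincidence (atom R ys) eq = subst (T ∘ rel 𝒜 R) (map-cong-∈ ys eq)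
  coincidence (y ≐ z) eq holds = trans (sym (eq y (inj₁ refl))) (trans holds (eq z (inj₂ refl)))
  coincidence (¬′ φ) eq ¬φ holds = ¬φ (coincidence φ (λ x → sym ∘ eq x) holds)
  coincidence (φ ∧′ ψ) eq (a , b) = coincidence φ (λ x → eq x ∘ inj₁) a , coincidence ψ (λ x → eq x ∘ inj₂) b
  coincidence (φ ∨′ ψ) eq (inj₁ a) = inj₁ (coincidence φ (λ x → eq x ∘ inj₁) a)
  coincidence (φ ∨′ ψ) eq (inj₂ b) = inj₂ (coincidence ψ (λ x → eq x ∘ inj₂) b)
  coincidence (∃′ i φ) eq (a , holds) = a , coincidence-[]≔ φ eq a holds
  coincidence (∀′ i φ) eq holds a = coincidence-[]≔ φ eq a (holds a)
  coincidence-[]≔ φ {i} {s} {t} eq a = coincidence φ λ x free → by x free (x Fin.≟ i)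
    where
    by : ∀ x → x FreeIn φ → Dec (x ≡ i) → lookup (s [ i ]≔ a) x ≡ lookup (t [ i ]≔ a) x
    by x free (yes refl) = trans (Vec.lookup∘update i s a) (sym (Vec.lookup∘update i t a))
    by x free (no x≢i)   = trans (Vec.lookup∘update′ x≢i s a)
      (trans (eq x (x≢i , free)) (sym (Vec.lookup∘update′ x≢i t a)))

  -- Supplies the case distinction needed to prove that two structures agree on a sentence.
  decide : ∀ {n} → HasSize 𝒜 n → ∀ (φ : Formula σ k) s → Dec (𝒜 , s ⊨ φ)
  decide size (atom R ys) s = T? _
  decide size (y ≐ z) s = map′ (Injection.injective (Inverse⇒Injection size)) (cong (Inverse.to size))
    (Inverse.to size (lookup s y) Fin.≟ Inverse.to size (lookup s z))
  decide size (¬′ φ) s = ¬? (decide size φ s)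
  decide size (φ ∧′ ψ) s = decide size φ s ×-dec decide size ψ s
  decide size (φ ∨′ ψ) s = decide size φ s ⊎-dec decide size ψ s
  decide size (∃′ i φ) s = map′ (λ (c , holds) → Inverse.from size c , holds)
    (λ (a , holds) → Inverse.to size a , subst (λ a → 𝒜 , s [ i ]≔ a ⊨ φ) (sym (Inverse.strictlyInverseʳ size a)) holds)
    (Fin.any? λ c → decide size φ (s [ i ]≔ Inverse.from size c))
  decide size (∀′ i φ) s = map′
    (λ holds a → subst (λ a → 𝒜 , s [ i ]≔ a ⊨ φ) (Inverse.strictlyInverseʳ size a) (holds (Inverse.to size a)))
    (λ holds c → holds (Inverse.from size c))
    (Fin.all? λ c → decide size φ (s [ i ]≔ Inverse.from size c))

  sentence-irrelevant : ∀ (φ : Sentence σ k) s t → 𝒜 , s ⊨ proj₁ φ → 𝒜 , t ⊨ proj₁ φ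
  sentence-irrelevant (φ , closed) s t = coincidence φ (λ x free → contradiction free (closed x))

∃* : ∀ {σ k} → List (Fin k) → Formula σ k → Formula σ k
∃* []       φ = φ
∃* (x ∷ xs) φ = ∃′ x (∃* xs φ)

∃*-free : ∀ {σ k} xs {φ : Formula σ k} {x} → x FreeIn ∃* xs φ → ¬ x ∈ xs
∃*-free (y ∷ xs) (x≢y , free) (here x≡y)   = x≢y x≡y
∃*-free (y ∷ xs) (x≢y , free) (there x∈xs) = ∃*-free xs free x∈xs

module _ {σ : Signature} {k : ℕ} (𝒜 : Structure σ) (φ : Formula σ k) where

  ∃*-intro : ∀ xs {s} → 𝒜 , s ⊨ φ → 𝒜 , s ⊨ ∃* xs φ
  ∃*-intro []       holds = holds
  ∃*-intro (x ∷ xs) {s} holds = lookup s x ,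
    subst (λ s → 𝒜 , s ⊨ ∃* xs φ) (sym (Vec.[]≔-lookup s x)) (∃*-intro xs holds)

  ∃*-elim : ∀ xs {s} → 𝒜 , s ⊨ ∃* xs φ → ∃[ t ] 𝒜 , t ⊨ φ
  ∃*-elim []       holds       = _ , holds
  ∃*-elim (x ∷ xs) (a , holds) = ∃*-elim xs holds

-- Spoiler's separating sentence.

module Spoiler (k : ℕ) (3≤k : 3 ≤ k) (D r : ℕ) where

  open Levels k 3≤k D
  open Game k 3≤k D r

  at : Fin k → Fin (suc D) → Formula sig k
  at τ l = atom (suc (Fin.combine τ l)) (τ ∷ [])

  equation : Formula sig k
  equation = atom zero (Vec.allFin k)

  at-sound : ∀ κ v {τ l} → κ ∣ v ⊩ at τ l → At (τ , l) (lookup v τ)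
  at-sound κ v {τ} {l} holds = subst (λ c → At c (lookup v τ)) (Fin.remQuot-combine τ l)
    (toWitness {a? = At? _ (lookup v τ)} holds)

  at-complete : ∀ κ v {τ l} → At (τ , l) (lookup v τ) → κ ∣ v ⊩ at τ l
  at-complete κ v {τ} {l} holds = fromWitness {a? = At? _ (lookup v τ)}
    (subst (λ c → At c (lookup v τ)) (sym (Fin.remQuot-combine τ l)) holds)

  Equation-resp : ∀ {κ x y} → (∀ ρ → x ρ ≡ y ρ) → Equation κ x → Equation κ y
  Equation-resp eq holds full = Legal-resp (λ ρ → cong lev (sym (eq ρ))) (λ ρ → null-≡ (cong val (sym (eq ρ))))
    (holds (λ ρ → trans (cong typ (eq ρ)) (full ρ)))

  lookup-allFin : ∀ (v : Pebbling) ρ → lookup (Vec.map (lookup v) (Vec.allFin k)) ρ ≡ lookup v ρ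
  lookup-allFin v ρ = trans (Vec.lookup-map ρ (lookup v) (Vec.allFin k)) (cong (lookup v) (Vec.lookup-allFin ρ))

  equation-sound : ∀ κ v → κ ∣ v ⊩ equation → Equation κ (lookup v)
  equation-sound κ v holds = Equation-resp (lookup-allFin v)
    (toWitness {a? = Equation? κ (lookup (Vec.map (lookup v) (Vec.allFin k)))} holds)

  equation-complete : ∀ κ v → Equation κ (lookup v) → κ ∣ v ⊩ equation
  equation-complete κ v holds = fromWitness {a? = Equation? κ (lookup (Vec.map (lookup v) (Vec.allFin k)))}
    (Equation-resp (sym ∘ lookup-allFin v) holds)

  Placed : (Fin k → ℕ) → Pebbling → Fin k → Set
  Placed l v ρ = typ (lookup v ρ) ≡ just ρ × lev (lookup v ρ) ≡ l ρ

  Zero : Pebbling → Fin k → Set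
  Zero v ρ = val (lookup v ρ) ≡ 0ℤ

  -- A strategy of Spoiler compiled into a formula: the zero tuple survives it on the left, and on
  -- the right it enforces that `E τ` vanishes. All conditions concern types other than `τ`, so the
  -- variable `τ` can be rebound.
  record Win (l : Fin k → ℕ) (τ : Fin k) : Set where
    field
      φ     : Formula sig k
      free  : ∀ x → x FreeIn φ → x ≢ τ
      left  : ∀ v → (∀ ρ → ρ ≢ τ → Placed l v ρ) → (∀ ρ → ρ ≢ τ → Zero v ρ) → 0ℤ ∣ v ⊩ φ
      right : ∀ v → (∀ ρ → ρ ≢ τ → Placed l v ρ) → 1ℤ ∣ v ⊩ φ → Null (E τ (val ∘ lookup v))

  Win-resp : ∀ {l l′ τ} → (∀ ρ → ρ ≢ τ → l′ ρ ≡ l ρ) → Win l τ → Win l′ τ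
  Win-resp {l} {l′} {τ} l′≗l win = record
    { φ = φ ; free = free ; left = λ v → left v ∘ old v ; right = λ v → right v ∘ old v }
    where
    open Win win
    old : ∀ v → (∀ ρ → ρ ≢ τ → Placed l′ v ρ) → (∀ ρ → ρ ≢ τ → Placed l v ρ)
    old v placed ρ ρ≢τ = let t , l = placed ρ ρ≢τ in t , trans l (l′≗l ρ ρ≢τ)

  -- On the left the witness is the zero element. On the right any witness of the right type and
  -- level will do, because `E τ` ignores its value.
  Win-∃ : ∀ {l τ} (ψ : Formula sig k) → l τ ≤ D →
          (∀ v → (∀ ρ → Placed l v ρ) → (∀ ρ → Zero v ρ) → 0ℤ ∣ v ⊩ ψ) →
          (∀ v → (∀ ρ → Placed l v ρ) → 1ℤ ∣ v ⊩ ψ → Null (E τ (val ∘ lookup v))) → Win l τ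
  Win-∃ {l} {τ} ψ lτ≤D left right = record
    { φ     = ∃′ τ (at τ lτ ∧′ ψ)
    ; free  = λ _ → proj₁
    ; left  = λ v placed zeros → e , at-complete 0ℤ (v [ τ ]≔ e)
        (subst (At (τ , lτ)) (sym (Vec.lookup∘update τ v e)) (refl , refl)) ,
        left (v [ τ ]≔ e) (extend v e (refl , toℕ-lτ) placed)
             (λ ρ → by {P = λ ρ e → val e ≡ 0ℤ} v e refl zeros ρ)
    ; right = λ v placed (a , at-a , holds) →
        let ta , la = subst (At (τ , lτ)) (Vec.lookup∘update τ v a) (at-sound 1ℤ (v [ τ ]≔ a) at-a)
        in E-resp τ (λ ρ ρ≢τ → null-≡ (cong val (sym (Vec.lookup∘update′ ρ≢τ v a))))
             (right (v [ τ ]≔ a) (extend v a (ta , trans la toℕ-lτ) placed) holds) }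
    where
    lτ : Fin (suc D)
    lτ = Fin.fromℕ< (s≤s lτ≤D)
    toℕ-lτ : toℕ lτ ≡ l τ
    toℕ-lτ = Fin.toℕ-fromℕ< (s≤s lτ≤D)
    e : Elem
    e = inj₁ (τ , lτ , zero)
    by : ∀ {P : Fin k → Elem → Set} v a → P τ a → (∀ ρ → ρ ≢ τ → P ρ (lookup v ρ)) → ∀ ρ → P ρ (lookup (v [ τ ]≔ a) ρ)
    by {P} v a new old ρ with ρ Fin.≟ τ
    ... | yes refl = subst (P τ) (sym (Vec.lookup∘update τ v a)) new
    ... | no ρ≢τ   = subst (P ρ) (sym (Vec.lookup∘update′ ρ≢τ v a)) (old ρ ρ≢τ)
    extend : ∀ v a → typ a ≡ just τ × lev a ≡ l τ → (∀ ρ → ρ ≢ τ → Placed l v ρ) → ∀ ρ → Placed l (v [ τ ]≔ a) ρ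
    extend v a = by {P = λ ρ e → typ e ≡ just ρ × lev e ≡ l ρ} v a

  legal-placed : ∀ κ v {l} → (∀ ρ → Placed l v ρ) → κ ∣ v ⊩ equation → Legal κ l (val ∘ lookup v)
  legal-placed κ v placed holds = Legal-resp (λ ρ → sym (proj₂ (placed ρ))) (λ ρ → null-≡ {val (lookup v ρ)} refl)
    (equation-sound κ v holds (proj₁ ∘ placed))

  zero-equation : ∀ v → (∀ ρ → Zero v ρ) → 0ℤ ∣ v ⊩ equation
  zero-equation v zeros = equation-complete 0ℤ v λ _ →
    (λ _ → null _) , (λ _ → null _ , null _) , (λ _ → subst Null (sym (ℤ.+-identityʳ _)) (null _))
    where
    null : ∀ c → Null (form c (val ∘ lookup v))
    null c = null-form c _ (λ ρ → null-* (c ρ) (subst Null (sym (zeros ρ)) null-0))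

  Win-bottom : ∀ {l τ} → l τ ≤ D → Const 0 l → Win l τ
  Win-bottom {τ = τ} lτ≤D const = Win-∃ equation lτ≤D (λ v _ → zero-equation v)
    λ v placed holds → let Z , E₀ = proj₁ (proj₂ (legal-placed 1ℤ v placed holds)) const in E-all {o} τ _ Z E₀

  -- The relation itself yields `Z₁ = 0`, so one subformula suffices.
  Win-hyper : ∀ {l τ σ} → l τ ≤ D → Hyper l → Win l σ → Win l τ
  Win-hyper {τ = τ} {σ} lτ≤D hyper win = Win-∃ (equation ∧′ φ) lτ≤D
    (λ v placed zeros → zero-equation v zeros , left v (λ ρ _ → placed ρ) (λ ρ _ → zeros ρ))
    λ v placed (eq , holds) → E-all {σ} τ _ (proj₁ (legal-placed 1ℤ v placed eq) hyper) (right v (λ ρ _ → placed ρ) holds)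
    where open Win win

  -- Two vanishing `E` yield `Z₁ = 0` and with it all the others. This conjunction is where the
  -- formula branches.
  Win-both : ∀ {l τ a b} → l τ ≤ D → a ≢ b → Win l a → Win l b → Win l τ
  Win-both {τ = τ} {a} {b} lτ≤D a≢b wina winb = Win-∃ (A.φ ∧′ B.φ) lτ≤D
    (λ v placed zeros → A.left v (λ ρ _ → placed ρ) (λ ρ _ → zeros ρ) , B.left v (λ ρ _ → placed ρ) (λ ρ _ → zeros ρ))
    λ v placed (holdsa , holdsb) →
      let Ea = A.right v (λ ρ _ → placed ρ) holdsa ; Eb = B.right v (λ ρ _ → placed ρ) holdsb
      in E-all {a} τ _ (Z₁-null _ a≢b Ea Eb) Ea
    where
    module A = Win wina
    module B = Win winb

  -- The positions between levels `suc d` and `d`: the raised types form an interval, and lowering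
  -- an end leaves a shorter one.
  interval : ℕ → ℕ → ℕ → Fin k → ℕ
  interval d i n ρ with i ≤? toℕ ρ | toℕ ρ <? i + n
  ... | yes _ | yes _ = suc d
  ... | _     | _     = d

  inside : ∀ d i n {ρ} → i ≤ toℕ ρ → toℕ ρ < i + n → interval d i n ρ ≡ suc d
  inside d i n {ρ} i≤ρ ρ<i+n with i ≤? toℕ ρ | toℕ ρ <? i + n
  ... | yes _  | yes _    = refl
  ... | yes _  | no ρ≮i+n = contradiction ρ<i+n ρ≮i+n
  ... | no i≰ρ | _        = contradiction i≤ρ i≰ρ

  outside : ∀ d i n {ρ} → ¬ (i ≤ toℕ ρ × toℕ ρ < i + n) → interval d i n ρ ≡ d
  outside d i n {ρ} out with i ≤? toℕ ρ | toℕ ρ <? i + n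
  ... | yes i≤ρ | yes ρ<i+n = contradiction (i≤ρ , ρ<i+n) out
  ... | yes _   | no _      = refl
  ... | no _    | yes _     = refl
  ... | no _    | no _      = refl

  interval≤ : ∀ d i n ρ → interval d i n ρ ≤ suc d
  interval≤ d i n ρ with i ≤? toℕ ρ | toℕ ρ <? i + n
  ... | yes _  | yes _ = ≤-refl
  ... | yes _  | no _  = n≤1+n d
  ... | no _   | yes _ = n≤1+n d
  ... | no _   | no _  = n≤1+n d

  interval-≡ : ∀ d {i n i′ n′ ρ} → (i ≤ toℕ ρ × toℕ ρ < i + n → i′ ≤ toℕ ρ × toℕ ρ < i′ + n′) →
               (i′ ≤ toℕ ρ × toℕ ρ < i′ + n′ → i ≤ toℕ ρ × toℕ ρ < i + n) →
               interval d i n ρ ≡ interval d i′ n′ ρ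
  interval-≡ d {i} {n} {i′} {n′} {ρ} to from with (i ≤? toℕ ρ) ×-dec (toℕ ρ <? i + n)
  ... | yes p@(a , b) = trans (inside d i n a b) (sym (inside d i′ n′ (proj₁ (to p)) (proj₂ (to p))))
  ... | no ¬p = trans (outside d i n ¬p) (sym (outside d i′ n′ (¬p ∘ from)))

  -- `Win` at a type ignores the level of that type. So at length two or more the first and last
  -- types `a` and `b` lead to intervals shorter by one; at length one the position is hyper and
  -- leads to constant level `d`.
  win-interval : ∀ {d} → suc d ≤ D → (∀ τ → Win (λ _ → d) τ) → ∀ n i → i + n ≤ k → ∀ τ → Win (interval d i n) τ
  win-interval {d} d<D win zero i _ τ = Win-resp (λ ρ _ → outside d i 0 λ (i≤ρ , ρ<i) →
    <⇒≱ ρ<i (≤-trans (≤-reflexive (+-identityʳ i)) i≤ρ)) (win τ)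
  win-interval {d} d<D win (suc zero) i i+1≤k τ = Win-hyper (≤-trans (interval≤ d i 1 τ) d<D)
    (a , λ ρ ρ≢a → trans (inside d i 1 (≤-reflexive (sym toℕ-a)) (≤-reflexive (trans (cong suc toℕ-a) (+-comm 1 i))))
                     (cong suc (sym (off ρ ρ≢a))))
    (Win-resp off (win a))
    where
    i<k : i < k
    i<k = ≤-trans (≤-reflexive (+-comm 1 i)) i+1≤k
    a : Fin k
    a = Fin.fromℕ< i<k
    toℕ-a : toℕ a ≡ i
    toℕ-a = Fin.toℕ-fromℕ< i<k
    off : ∀ ρ → ρ ≢ a → interval d i 1 ρ ≡ d
    off ρ ρ≢a = outside d i 1 λ (i≤ρ , ρ<i+1) → ρ≢a (Fin.toℕ-injective (trans
      (≤-antisym (s≤s⁻¹ (≤-trans ρ<i+1 (≤-reflexive (+-comm i 1)))) i≤ρ) (sym toℕ-a)))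
  win-interval {d} d<D win (suc (suc n)) i i+n≤k τ = Win-both (≤-trans (interval≤ d i (2 + n) τ) d<D) a≢b
    (Win-resp (λ ρ ρ≢a → interval-≡ d
        (λ (i≤ρ , ρ<) → ≤∧≢⇒< i≤ρ (λ i≡ρ → ρ≢a (Fin.toℕ-injective (trans (sym i≡ρ) (sym toℕ-a)))) ,
                        ≤-trans ρ< (≤-reflexive (+-suc i (suc n))))
        (λ (i<ρ , ρ<) → <⇒≤ i<ρ , ≤-trans ρ< (≤-reflexive (sym (+-suc i (suc n))))))
      (win-interval d<D win (suc n) (suc i) (≤-trans (≤-reflexive (sym (+-suc i (suc n)))) i+n≤k) a))
    (Win-resp (λ ρ ρ≢b → interval-≡ d
        (λ (i≤ρ , ρ<) → i≤ρ , ≤∧≢⇒< (s≤s⁻¹ (≤-trans ρ< (≤-reflexive (+-suc i (suc n)))))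
                                 (λ ρ≡ → ρ≢b (Fin.toℕ-injective (trans ρ≡ (sym toℕ-b)))))
        (λ (i≤ρ , ρ<) → i≤ρ , <-≤-trans ρ< (+-monoʳ-≤ i (n≤1+n (suc n)))))
      (win-interval d<D win (suc n) i (≤-trans (+-monoʳ-≤ i (n≤1+n (suc n))) i+n≤k) b))
    where
    i+n<k : i + suc n < k
    i+n<k = ≤-trans (≤-reflexive (sym (+-suc i (suc n)))) i+n≤k
    i<k : i < k
    i<k = ≤-<-trans (m≤m+n i (suc n)) i+n<k
    a b : Fin k
    a = Fin.fromℕ< i<k
    b = Fin.fromℕ< i+n<k
    toℕ-a : toℕ a ≡ i
    toℕ-a = Fin.toℕ-fromℕ< i<k
    toℕ-b : toℕ b ≡ i + suc n
    toℕ-b = Fin.toℕ-fromℕ< i+n<k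
    a≢b : a ≢ b
    a≢b a≡b = m≢1+m+n i (trans (sym toℕ-a) (trans (cong toℕ a≡b) (trans toℕ-b (+-suc i n))))

  win : ∀ d → d ≤ D → ∀ τ → Win (λ _ → d) τ
  win zero    _   τ = Win-bottom z≤n (λ _ → refl)
  win (suc d) d<D τ = Win-resp (λ ρ _ → sym (inside d 0 k z≤n (Fin.toℕ<n ρ)))
    (win-interval d<D (win d (<⇒≤ d<D)) k 0 ≤-refl τ)

  at-top : List (Fin k) → Formula sig k → Formula sig k
  at-top []       φ = φ
  at-top (ρ ∷ ρs) φ = at ρ (Fin.fromℕ D) ∧′ at-top ρs φ

  top-sound : ∀ ρs {φ} κ v → κ ∣ v ⊩ at-top ρs φ → (∀ {ρ} → ρ ∈ ρs → Placed (λ _ → D) v ρ) × κ ∣ v ⊩ φ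
  top-sound []       κ v holds = (λ ()) , holds
  top-sound (ρ ∷ ρs) κ v (at-ρ , holds) = (λ where
      (here refl)  → let t , l = at-sound κ v at-ρ in t , trans l (Fin.toℕ-fromℕ D)
      (there ρ∈ρs) → proj₁ (top-sound ρs κ v holds) ρ∈ρs)
    , proj₂ (top-sound ρs κ v holds)

  top-complete : ∀ ρs {φ} κ v → (∀ ρ → Placed (λ _ → D) v ρ) → κ ∣ v ⊩ φ → κ ∣ v ⊩ at-top ρs φ
  top-complete []       κ v placed holds = holds
  top-complete (ρ ∷ ρs) κ v placed holds =
    at-complete κ v (proj₁ (placed ρ) , trans (proj₂ (placed ρ)) (sym (Fin.toℕ-fromℕ D))) ,
    top-complete ρs κ v placed holds

  o′ : Fin k
  o′ = proj₁ (third 3≤k o o)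

  open Win (win D ≤-refl o) using () renaming (φ to φ₀; left to left₀; right to right₀)
  open Win (win D ≤-refl o′) using () renaming (φ to φ₁; left to left₁; right to right₁)

  -- Two types suffice at the top: if `E o` and `E o′` vanish, then `Z₁ = 0`, whereas the relation
  -- of the second structure demands `Z₁ = 1`.
  matrix : Formula sig k
  matrix = at-top (List.allFin k) (equation ∧′ φ₀ ∧′ φ₁)

  separating : Sentence sig k
  separating = ∃* (List.allFin k) matrix , λ x free → ∃*-free (List.allFin k) free (∈-allFin x)

  origin : Pebbling
  origin = Vec.tabulate (λ ρ → inj₁ (ρ , Fin.fromℕ D , zero))

  left-holds : struct 0ℤ ⊨ separating
  left-holds s = sentence-irrelevant (struct 0ℤ) separating origin s
    (∃*-intro (struct 0ℤ) matrix (List.allFin k)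
      (top-complete (List.allFin k) 0ℤ origin placed
        (zero-equation origin zeros , left₀ origin (λ ρ _ → placed ρ) (λ ρ _ → zeros ρ) , left₁ origin (λ ρ _ → placed ρ) (λ ρ _ → zeros ρ))))
    where
    lookup-origin : ∀ ρ → lookup origin ρ ≡ inj₁ (ρ , Fin.fromℕ D , zero)
    lookup-origin = Vec.lookup∘tabulate _
    placed : ∀ ρ → Placed (λ _ → D) origin ρ
    placed ρ rewrite lookup-origin ρ = refl , Fin.toℕ-fromℕ D
    zeros : ∀ ρ → Zero origin ρ
    zeros ρ = cong val (lookup-origin ρ)

  ¬null-1 : ¬ Null 1ℤ
  ¬null-1 null = <⇒≱ (s≤s (1≤n! k)) (ℕ.∣⇒≤ (Signed.∣⇒∣ᵤ null))

  right-fails : ∀ s → ¬ (1ℤ ∣ s ⊩ proj₁ separating)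
  right-fails s holds =
    let v , holds-v = ∃*-elim (struct 1ℤ) matrix (List.allFin k) holds
        placed′ , (eq , h₀ , h₁) = top-sound (List.allFin k) 1ℤ v holds-v
        placed ρ = placed′ (∈-allFin ρ)
        Z₁-1 = proj₂ (proj₂ (legal-placed 1ℤ v placed eq)) (λ _ → refl)
        Z₁0 = Z₁-null _ (proj₁ (proj₂ (third 3≤k o o)) ∘ sym) (right₀ v (λ ρ _ → placed ρ) h₀) (right₁ v (λ ρ _ → placed ρ) h₁)
    in ¬null-1 (subst Null (lemma (Z₁ (val ∘ lookup v))) (null-+ Z₁0 (null-neg Z₁-1)))
    where
    lemma : ∀ a → a ℤ.+ (ℤ.- (a ℤ.- 1ℤ)) ≡ 1ℤ
    lemma = solve-∀

-- Agreement on small sentences and the choice of constants.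

module Agreement (k : ℕ) (3≤k : 3 ≤ k) (D r : ℕ) where

  open Levels k 3≤k D
  open Pebbles k 3≤k D
  open Game k 3≤k D r

  start : Pebbling
  start = Vec.replicate k (inj₁ (o , zero , zero))

  -- Only one type is in play, so there is no legality condition to check.
  close : ∀ X κ κ′ → Close X κ κ′ start start
  close X κ κ′ = record
    { coupled = record
        { similar = record { typ≡ = λ _ → refl ; lev≡ = λ _ → refl }
        ; facts = record
            { flat = λ {j} {j′} _ _ _ _ → inj₁ (null-+ (still j) (null-neg (still j′)))
            ; line = λ τ p _ → inj₁ (null-form (coeff τ) _ (λ ρ → null-* (coeff τ ρ) (still (p ρ)))) } }
    ; lawful = λ p full → let ρ , ρ≢o , _ = third 3≤k o o in
        contradiction (Maybe.just-injective (trans (sym (full ρ))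
          (cong typ (Vec.lookup-replicate (p ρ) (inj₁ (o , zero , zero)))))) ρ≢o }
    where
    still : ∀ m → Null (shift start start m)
    still m = null-≡ {val (lookup start m)} refl

  agreement : ∀ {n} → HasSize (struct 0ℤ) n → (φ : Sentence sig k) → quantifiers (proj₁ φ) < 2 ^ D →
              AgreeOn (struct 0ℤ) (struct 1ℤ) φ
  agreement size (φ , closed) q<2^D with decide (struct 0ℤ) size φ start
  ... | yes holds = inj₁
        ( (λ s → sentence-irrelevant (struct 0ℤ) (φ , closed) start s holds)
        , (λ s → sentence-irrelevant (struct 1ℤ) (φ , closed) start s
                   (transfer φ q<2^D q<2^D (close (2 ^ D) 0ℤ 1ℤ) holds)))
  ... | no fails = inj₂
        ( (λ holds → fails (holds start))
        , (λ holds → fails (transfer φ q<2^D q<2^D (close (2 ^ D) 1ℤ 0ℤ) (holds start))))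

  Elem-size : Elem ↔ Fin (k * (suc D * modulus) + r)
  Elem-size = ↔-sym (↔-trans Fin.+↔⊎ (↔-trans Fin.*↔× (↔-refl ×-cong Fin.*↔×) ⊎-cong ↔-refl))

-- If `m` were at least `2 ^ D`, its power `suc e` would be at least `2 ^ n`.
<2^-bound : ∀ {m n} D e → n ≤ D * suc e → m <2^ (mkℚᵘ (+ 1) e *ᵘ (+ n / 1)) → m < 2 ^ D
<2^-bound {m} {n} D e n≤ small = ≰⇒> λ 2^D≤m → <⇒≱ small′ (begin
  2 ^ n                ≤⟨ 2^-mono-≤ n≤ ⟩
  2 ^ (D * suc e)      ≡⟨ ^-*-assoc 2 D (suc e) ⟨
  (2 ^ D) ^ suc e      ≤⟨ ^-monoˡ-≤ (suc e) 2^D≤m ⟩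
  m ^ suc e            ∎)
  where
  open ≤-Reasoning
  small′ : m ^ suc e < 2 ^ n
  small′ = subst₂ (λ i d → m <2^ mkℚᵘ i d) (ℤ.*-identityˡ (+ n)) (*-identityʳ e) small

theorem1 : (k : ℕ) → 3 ≤ k →
    Σ[ ε ∈ ℚᵘ ] (0ℚᵘ <ᵘ ε × (Σ[ n₀ ∈ ℕ ] ((n : ℕ) → n₀ < n →
    Σ[ σ ∈ Signature ] Σ[ 𝒜 ∈ Structure σ ] Σ[ ℬ ∈ Structure σ ]
    ( IsAry k 𝒜 × IsAry k ℬ
    × HasSize 𝒜 n × HasSize ℬ n
    × (Σ[ φ ∈ Sentence σ k ] Distinguishes φ 𝒜 ℬ)
    × ((φ : Sentence σ k) → quantifiers (proj₁ φ) <2^ (ε *ᵘ (+ n / 1)) → AgreeOn 𝒜 ℬ φ)))))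
-- One level takes `B` elements and there are `D + 1` levels, so `D` is one less than the quotient
-- of `n` by `B`, and the remainder is padding. The denominator of `ε` is `2 * B + 1`.
theorem1 k 3≤k = mkℚᵘ (+ 1) (2 * B) , *<* (ℤ.+<+ (s≤s z≤n)) , 3 * B , λ n 3B<n →
  let D = pred (n DivMod./ B)
      r = n DivMod.% B
      open Game k 3≤k D r
      open Agreement k 3≤k D r
      open Spoiler k 3≤k D r
      size = subst (λ n → Elem ↔ Fin n) (sym (decompose n 3B<n)) Elem-size
  in sig , struct 0ℤ , struct 1ℤ
   , ary D r , ary D r
   , size , size
   , (separating , [ (λ (_ , holds) → right-fails start (holds start)) , (λ (fails , _) → fails left-holds) ]′)
   , λ φ small → agreement size φ (<2^-bound D (2 * B) (bound n 3B<n) small)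
  where
  open Residues k using (modulus)
  B : ℕ
  B = k * modulus
  instance
    B≢0 : NonZero B
    B≢0 = m*n≢0 k modulus {{>-nonZero (≤-trans (s≤s z≤n) 3≤k)}}
  ary : ∀ D r → (R : Symbol (Game.sig k 3≤k D r)) → arity (Game.sig k 3≤k D r) R ≤ k
  ary D r zero    = ≤-refl
  ary D r (suc _) = ≤-trans (s≤s z≤n) 3≤k
  3≤n/B : ∀ n → 3 * B < n → 3 ≤ n DivMod./ B
  3≤n/B n 3B<n = ≤-trans (≤-reflexive (sym (DivMod.m*n/n≡m 3 B))) (DivMod./-monoˡ-≤ B (<⇒≤ 3B<n))
  suc-pred-/ : ∀ n → 3 * B < n → suc (pred (n DivMod./ B)) ≡ n DivMod./ B
  suc-pred-/ n 3B<n = suc-pred _ {{>-nonZero (≤-trans (s≤s z≤n) (3≤n/B n 3B<n))}}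
  decompose : ∀ n → 3 * B < n → n ≡ k * (suc (pred (n DivMod./ B)) * modulus) + n DivMod.% B
  decompose n 3B<n = begin
    n                                             ≡⟨ DivMod.m≡m%n+[m/n]*n n B ⟩
    n DivMod.% B + n DivMod./ B * B               ≡⟨ +-comm (n DivMod.% B) _ ⟩
    n DivMod./ B * B + n DivMod.% B               ≡⟨ cong (λ l → l * B + n DivMod.% B) (suc-pred-/ n 3B<n) ⟨
    suc D * (k * modulus) + n DivMod.% B          ≡⟨ cong (_+ n DivMod.% B) (x∙yz≈y∙xz *-commutativeSemigroup (suc D) k modulus) ⟩
    k * (suc D * modulus) + n DivMod.% B          ∎
    where
    open ≡-Reasoning
    D = pred (n DivMod./ B)
  -- Since `n` exceeds `3 * B`, `D` is at least 2, which absorbs both the extra level and the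
  -- remainder.
  bound : ∀ n → 3 * B < n → n ≤ pred (n DivMod./ B) * suc (2 * B)
  bound n 3B<n = begin
    n                                             ≡⟨ DivMod.m≡m%n+[m/n]*n n B ⟩
    n DivMod.% B + n DivMod./ B * B               ≡⟨ cong (λ l → n DivMod.% B + l * B) (suc-pred-/ n 3B<n) ⟨
    n DivMod.% B + suc D * B                      ≤⟨ +-monoˡ-≤ (suc D * B) (<⇒≤ (DivMod.m%n<n n B)) ⟩
    (2 + D) * B                                   ≤⟨ *-monoˡ-≤ B (+-monoˡ-≤ D 2≤D) ⟩
    (D + D) * B                                   ≡⟨ cong (_* B) (cong (λ m → D + m) (+-identityʳ D)) ⟨
    2 * D * B                                     ≡⟨ cong (_* B) (*-comm 2 D) ⟩
    D * 2 * B                                     ≡⟨ *-assoc D 2 B ⟩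
    D * (2 * B)                                   ≤⟨ *-monoʳ-≤ D (n≤1+n (2 * B)) ⟩
    D * suc (2 * B)                               ∎
    where
    open ≤-Reasoning
    D = pred (n DivMod./ B)
    2≤D : 2 ≤ D
    2≤D = pred-mono-≤ (3≤n/B n 3B<n)
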